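{- For every $n\geq1$, $\mathrm{NID}\notin\Sigma_n$ and $\mathrm{NID}\notin\Pi_n$. Equivalently, for every computable $f:\{0,1\}^*\times\{0,1\}^*\times\omega\to\mathbb{Q}$ with $\lim_{s\to\infty}f(x,y,s)=\mathrm{NID}(x,y)$ for all $x,y$, the number of oscillations (changes between nondecreasing and nonincreasing phases) of $s\mapsto f(x,y,s)$ is not bounded by any constant uniformly in $(x,y)$.
   Context: Fix a universal prefix-free machine $U$. $K$ denotes prefix-free Kolmogorov complexity and $K(x\mid y)$ conditional prefix-free complexity. For binary strings $x,y$ let $E(x,y)=\max\{K(x\mid y),K(y\mid x)\}$ and $\mathrm{NID}(x,y)=\dfrac{E(x,y)}{\max\{K(x),K(y)\}}$, a rational-valued limit-computable function. The oscillation classes: an approximation of $F$ is a computable $f$ with $\lim_{s\to\infty}f(z,s)=F(z)$ for all $z$; $F\in\Sigma_1$ if it has an approximation nondecreasing in $s$; $F\in\Pi_1$ if it has one nonincreasing in $s$; $F\in\Sigma_{n+1}$ if it has a computable approximation $f$ such that for every $z$ there is $s_z$ with $f(z,t)$ nondecreasing for $t<s_z$ and $(f(z,t))_{t\geq s_z}$ a $\Pi_n$-approximation; $F\in\Pi_{n+1}$ likewise with nonincreasing for $t<s_z$ and $(f(z,t))_{t\geq s_z}$ a $\Sigma_n$-approximation. -}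

module Defs where

open import Data.Bool using (Bool; true; false)
open import Data.Fin using (Fin)
open import Data.Integer using (+_; _⊖_)
open import Data.List using (List; []; _∷_; _++_; length)
open import Data.Nat using (ℕ; zero; suc; _+_; _*_; _⊔_; _≤_; _<_; NonZero)
open import Data.Product using (Σ; ∃; ∃-syntax; _×_; _,_)
open import Data.Rational using (ℚ; 0ℚ; _/_; ∣_∣; _-_) renaming (_≤_ to _≤ℚ_; _<_ to _<ℚ_)
open import Data.Vec using (Vec; []; _∷_; lookup)
open import Function.Bundles using (_⇔_)
open import Relation.Binary.PropositionalEquality using (_≡_)
open import Relation.Nullary using (¬_)

-- Kleene's partial recursive functions ℕⁿ ⇀ ℕ.

data PR : ℕ → Set where
  zer  : PR 0
  succ : PR 1
  proj : ∀ {n} → Fin n → PR n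
  comp : ∀ {m n} → PR m → Vec (PR n) m → PR n
  prec : ∀ {n} → PR n → PR (2 + n) → PR (1 + n)
  mu   : ∀ {n} → PR (1 + n) → PR n

infix 4 _⟨_⟩⇓_ _⟨_⟩⇓*_

mutual
  -- f ⟨ xs ⟩⇓ v : f is defined at xs, with value v.
  data _⟨_⟩⇓_ : ∀ {n} → PR n → Vec ℕ n → ℕ → Set where
    zer⇓   : zer ⟨ [] ⟩⇓ 0
    succ⇓  : ∀ {x} → succ ⟨ x ∷ [] ⟩⇓ suc x
    proj⇓  : ∀ {n} {i : Fin n} {xs} → proj i ⟨ xs ⟩⇓ lookup xs i
    comp⇓  : ∀ {m n} {f : PR m} {gs : Vec (PR n) m} {xs ys v} →
             gs ⟨ xs ⟩⇓* ys → f ⟨ ys ⟩⇓ v → comp f gs ⟨ xs ⟩⇓ v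
    prec⇓₀ : ∀ {n} {g : PR n} {h xs v} →
             g ⟨ xs ⟩⇓ v → prec g h ⟨ 0 ∷ xs ⟩⇓ v
    prec⇓₊ : ∀ {n} {g : PR n} {h xs m r v} →
             prec g h ⟨ m ∷ xs ⟩⇓ r → h ⟨ m ∷ r ∷ xs ⟩⇓ v →
             prec g h ⟨ suc m ∷ xs ⟩⇓ v
    mu⇓    : ∀ {n} {f : PR (1 + n)} {xs k} →
             (∀ j → j < k → ∃[ v ] f ⟨ j ∷ xs ⟩⇓ suc v) →
             f ⟨ k ∷ xs ⟩⇓ 0 → mu f ⟨ xs ⟩⇓ k

  data _⟨_⟩⇓*_ {n} : ∀ {m} → Vec (PR n) m → Vec ℕ n → Vec ℕ m → Set where
    []  : ∀ {xs} → [] ⟨ xs ⟩⇓* []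
    _∷_ : ∀ {m} {g : PR n} {gs : Vec (PR n) m} {xs v vs} →
          g ⟨ xs ⟩⇓ v → gs ⟨ xs ⟩⇓* vs → (g ∷ gs) ⟨ xs ⟩⇓* (v ∷ vs)

Str : Set
Str = List Bool

-- Bijective base-2 numeration: a bijection between binary strings and ℕ.
code : Str → ℕ
code []          = 0
code (false ∷ w) = 1 + 2 * code w
code (true  ∷ w) = 2 + 2 * code w

-- A machine takes a program and a condition, in this order.
Machine : Set
Machine = PR 2

-- Outputs M p y x : on program p and condition y, M halts with output x.
Outputs : Machine → Str → Str → Str → Set
Outputs M p y x = M ⟨ code p ∷ code y ∷ [] ⟩⇓ code x

Halts : Machine → Str → Str → Set
Halts M p y = ∃[ x ] Outputs M p y x

PrefixFree : Machine → Set
PrefixFree M = ∀ y p r → Halts M p y → Halts M (p ++ r) y → r ≡ []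

Universal : Machine → Set
Universal U =
  ∀ (M : Machine) → PrefixFree M →
  ∃[ ρ ] (∀ p y x → Outputs U (ρ ++ p) y x ⇔ Outputs M p y x)

UniversalPrefixFree : Machine → Set
UniversalPrefixFree U = PrefixFree U × Universal U

-- K x y is K(x ∣ y), the least length of a program producing x from y.  It is
-- a specification rather than a definition because this function is not
-- computable.
IsComplexityOf : Machine → (Str → Str → ℕ) → Set
IsComplexityOf U K =
  ∀ x y → (∃[ p ] Outputs U p y x × length p ≡ K x y)
        × (∀ p → Outputs U p y x → K x y ≤ length p)

module Distance (K : Str → Str → ℕ) where

  -- Unconditional complexity is complexity relative to the empty string.
  K₀ : Str → ℕ
  K₀ x = K x []

  E : Str → Str → ℕ
  E x y = K x y ⊔ K y x

  -- The value at denominator 0 is a convention: if K is the complexity of a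
  -- universal prefix-free machine then K₀ x ≥ 1, since the empty program
  -- cannot halt on the empty condition.
  ratio : ℕ → ℕ → ℚ
  ratio a zero    = 0ℚ
  ratio a (suc b) = + a / suc b

  NID : Str × Str → ℚ
  NID (x , y) = ratio (E x y) (K₀ x ⊔ K₀ y)

open Distance public using (NID)

-- Rational values are presented as (a − b) / (1 + c), with a, b, c recursive.
Computable : (Str × Str → ℕ → ℚ) → Set
Computable f =
  Σ (PR 3) λ a → Σ (PR 3) λ b → Σ (PR 3) λ c → ∀ x y s →
    let args = code x ∷ code y ∷ s ∷ [] in
    ∃[ α ] ∃[ β ] ∃[ γ ]
      a ⟨ args ⟩⇓ α × b ⟨ args ⟩⇓ β × c ⟨ args ⟩⇓ γ ×
      f (x , y) s ≡ (α ⊖ β) / suc γ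

ConvergesTo : (ℕ → ℚ) → ℚ → Set
ConvergesTo g q =
  ∀ ε → 0ℚ <ℚ ε → ∃[ N ] (∀ s → N ≤ s → ∣ g s - q ∣ <ℚ ε)

IsApproximation : (Str × Str → ℕ → ℚ) → (Str × Str → ℚ) → Set
IsApproximation f F = Computable f × (∀ z → ConvergesTo (f z) (F z))

Nondecreasing Nonincreasing : (ℕ → ℚ) → Set
Nondecreasing g = ∀ t → g t ≤ℚ g (suc t)
Nonincreasing g = ∀ t → g (suc t) ≤ℚ g t

-- Monotonicity of the finite segment g 0, …, g (s − 1); nothing is required of
-- the step from g (s − 1) to g s.
NondecreasingBelow NonincreasingBelow : ℕ → (ℕ → ℚ) → Set
NondecreasingBelow s g = ∀ t → suc t < s → g t ≤ℚ g (suc t)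
NonincreasingBelow s g = ∀ t → suc t < s → g (suc t) ≤ℚ g t

-- The oscillation pattern of one sequence of a Σₙ- or Πₙ-approximation, n ≥ 1.
mutual
  ΣSequence : (n : ℕ) .{{_ : NonZero n}} → (ℕ → ℚ) → Set
  ΣSequence (suc zero)    g = Nondecreasing g
  ΣSequence (suc (suc n)) g =
    ∃[ s ] NondecreasingBelow s g × ΠSequence (suc n) (λ t → g (s + t))

  ΠSequence : (n : ℕ) .{{_ : NonZero n}} → (ℕ → ℚ) → Set
  ΠSequence (suc zero)    g = Nonincreasing g
  ΠSequence (suc (suc n)) g =
    ∃[ s ] NonincreasingBelow s g × ΣSequence (suc n) (λ t → g (s + t))

infix 4 _∈Σ[_] _∈Π[_]

_∈Σ[_] _∈Π[_] : (Str × Str → ℚ) → (n : ℕ) .{{_ : NonZero n}} → Set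
F ∈Σ[ n ] = ∃[ f ] IsApproximation f F × (∀ z → ΣSequence n (f z))
F ∈Π[ n ] = ∃[ f ] IsApproximation f F × (∀ z → ΠSequence n (f z))

data Direction : Set where
  up down : Direction

opposite : Direction → Direction
opposite up   = down
opposite down = up

Moves : Direction → ℚ → ℚ → Set
Moves up   p q = p <ℚ q
Moves down p q = q <ℚ p

-- Zigzag g d s k : there are times s = t₀ < t₁ < … < tₖ₊₁ between which g makes
-- k + 1 strict moves of alternating directions, the first one in direction d;
-- thus g changes direction at least k times after time s.
data Zigzag (g : ℕ → ℚ) : Direction → ℕ → ℕ → Set where
  move : ∀ {d s t} → s < t → Moves d (g s) (g t) → Zigzag g d s 0
  turn : ∀ {d s t k} → s < t → Moves d (g s) (g t) →
         Zigzag g (opposite d) t k → Zigzag g d s (suc k)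

OscillationsAtMost : ℕ → (ℕ → ℚ) → Set
OscillationsAtMost b g = ∀ d s → ¬ Zigzag g d s (suc b)

{-# OPTIONS --safe #-}

-- Let f approximate NID, and call a time s an event of f at (x , y) if f lies
-- above ½ there or, alternately, below ½.  Numbers are grouped into blocks of
-- length N = 2ⁿ; at the next lower level blocks have length 2^(n/8).  Suppose
-- u, v are blocks of length N, found by a recursive search with parameter k
-- (where n is proportional to k).  Then K(x), K(y) ≤ n + O(k) for x in u, y in
-- v, while K(x|y) ≥ n − k for all but a fraction 2⁻ᵏ of the pairs; so f exceeds
-- ½ at almost all pairs, and by averaging there is a bijection between the
-- subblocks of u and of v such that this has been observed at almost all pairs
-- from matched subblocks.  Search for it.  A matched pair now satisfies
-- K(x|y), K(y|x) ≤ n/8 + O(k), whereas K(x) ≥ n − k for most x; so f falls below ½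
-- at almost all matched pairs, and by averaging there is one pair of matched
-- subblocks on which this has been observed almost everywhere.  Search for it,
-- and repeat.  Each event costs a fraction 2⁻ᵏ of the pairs, so for large k a
-- pair with any prescribed number of events survives.  The complexity bounds
-- from below are mere counting, and those from above need only one machine for
-- each search.
module Submission where

open import Algebra.Properties.Group using (⁻¹-involutive)
open import Data.Bool using (true; false)
open import Data.Empty using (⊥-elim)
open import Data.Fin using (Fin; zero; suc; #_)
open import Data.Integer as ℤ using (_⊖_) renaming (+_ to pos)
import Data.Integer.Properties as ℤ
open import Data.List using ([]; _∷_; _++_; length)
open import Data.List.Properties using (length-++; ∷-injectiveʳ; ++-identityʳ)
open import Data.Nat hiding (_/_)
open import Data.Nat.Properties
open import Data.Nat.Tactic.RingSolver using (solve-∀)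
open import Data.Product using (∃-syntax; _×_; _,_; proj₁; proj₂)
open import Data.Rational as ℚ using (ℚ; 0ℚ; _/_; fromℚᵘ)
import Data.Rational.Properties as ℚ
open import Data.Rational.Unnormalised as ℚᵘ using (mkℚᵘ)
import Data.Rational.Unnormalised.Properties as ℚᵘ
open import Data.Sum using (inj₁; inj₂)
open import Data.Vec using (Vec; []; _∷_; lookup; tabulate)
open import Function using (_∘_; id)
open import Function.Bundles using (Equivalence)
open import Relation.Binary.Definitions using (tri<; tri≈; tri>)
open import Relation.Binary.PropositionalEquality
open import Relation.Nullary using (¬_; yes; no)
open import Defs

-- Programming with partial recursive functions

mutual
  ⇓-deterministic : ∀ {n} {f : PR n} {xs v w} → f ⟨ xs ⟩⇓ v → f ⟨ xs ⟩⇓ w → v ≡ w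
  ⇓-deterministic zer⇓ zer⇓ = refl
  ⇓-deterministic succ⇓ succ⇓ = refl
  ⇓-deterministic proj⇓ proj⇓ = refl
  ⇓-deterministic (comp⇓ gs f) (comp⇓ gs′ f′)
    with refl ← ⇓*-deterministic gs gs′ = ⇓-deterministic f f′
  ⇓-deterministic (prec⇓₀ g) (prec⇓₀ g′) = ⇓-deterministic g g′
  ⇓-deterministic (prec⇓₊ r h) (prec⇓₊ r′ h′)
    with refl ← ⇓-deterministic r r′ = ⇓-deterministic h h′
  ⇓-deterministic (mu⇓ {k = k} below at) (mu⇓ {k = k′} below′ at′) with <-cmp k k′
  ... | tri< k<k′ _ _ = ⊥-elim (0≢1+n (⇓-deterministic at (proj₂ (below′ k k<k′))))
  ... | tri≈ _ k≡k′ _ = k≡k′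
  ... | tri> _ _ k′<k = ⊥-elim (1+n≢0 (⇓-deterministic (proj₂ (below k′ k′<k)) at′))

  ⇓*-deterministic : ∀ {m n} {gs : Vec (PR n) m} {xs vs ws} →
                     gs ⟨ xs ⟩⇓* vs → gs ⟨ xs ⟩⇓* ws → vs ≡ ws
  ⇓*-deterministic [] [] = refl
  ⇓*-deterministic (g ∷ gs) (g′ ∷ gs′) =
    cong₂ _∷_ (⇓-deterministic g g′) (⇓*-deterministic gs gs′)

∑ ∏ : ℕ → (ℕ → ℕ) → ℕ
∑ zero    f = 0
∑ (suc n) f = ∑ n f + f n
∏ zero    f = 1
∏ (suc n) f = ∏ n f * f n

projections : ∀ {m n} → (Fin m → Fin n) → Vec (PR n) m
projections σ = tabulate (λ i → proj (σ i))

projections⇓ : ∀ {m n} (σ : Fin m → Fin n) {xs ys} →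
               (∀ i → lookup xs (σ i) ≡ lookup ys i) → projections σ ⟨ xs ⟩⇓* ys
projections⇓ σ {ys = []}     eq = []
projections⇓ σ {xs} {y ∷ ys} eq =
  subst (proj (σ zero) ⟨ xs ⟩⇓_) (eq zero) proj⇓ ∷ projections⇓ (σ ∘ suc) (eq ∘ suc)

constant : ∀ {n} → ℕ → PR n
constant zero    = comp zer []
constant (suc c) = comp succ (constant c ∷ [])

const⇓ : ∀ {n} c {xs : Vec ℕ n} → constant c ⟨ xs ⟩⇓ c
const⇓ zero    = comp⇓ [] zer⇓
const⇓ (suc c) = comp⇓ (const⇓ c ∷ []) succ⇓

add mul sub : PR 2
predecessor pow : PR 1
add = prec (proj (# 0)) (comp succ (proj (# 1) ∷ []))
mul = prec (constant 0) (comp add (proj (# 2) ∷ proj (# 1) ∷ []))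
predecessor = prec zer (proj (# 0))
-- sub ⟨ y ∷ x ∷ [] ⟩ computes x ∸ y: the recursion is on the subtrahend.
sub = prec (proj (# 0)) (comp predecessor (proj (# 1) ∷ []))
pow = prec (constant 1) (comp mul (constant 2 ∷ proj (# 1) ∷ []))

add⇓ : ∀ x y → add ⟨ x ∷ y ∷ [] ⟩⇓ x + y
add⇓ zero    y = prec⇓₀ proj⇓
add⇓ (suc x) y = prec⇓₊ (add⇓ x y) (comp⇓ (proj⇓ ∷ []) succ⇓)

mul⇓ : ∀ x y → mul ⟨ x ∷ y ∷ [] ⟩⇓ x * y
mul⇓ zero    y = prec⇓₀ (const⇓ 0)
mul⇓ (suc x) y = prec⇓₊ (mul⇓ x y) (comp⇓ (proj⇓ ∷ proj⇓ ∷ []) (add⇓ y (x * y)))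

pred⇓ : ∀ x → predecessor ⟨ x ∷ [] ⟩⇓ pred x
pred⇓ zero    = prec⇓₀ zer⇓
pred⇓ (suc x) = prec⇓₊ (pred⇓ x) proj⇓

sub⇓ : ∀ y x → sub ⟨ y ∷ x ∷ [] ⟩⇓ x ∸ y
sub⇓ zero    x = prec⇓₀ proj⇓
sub⇓ (suc y) x =
  subst (sub ⟨ suc y ∷ x ∷ [] ⟩⇓_) (pred[m∸n]≡m∸[1+n] x y)
    (prec⇓₊ (sub⇓ y x) (comp⇓ (proj⇓ ∷ []) (pred⇓ (x ∸ y))))

pow⇓ : ∀ x → pow ⟨ x ∷ [] ⟩⇓ 2 ^ x
pow⇓ zero    = prec⇓₀ (const⇓ 1)
pow⇓ (suc x) = prec⇓₊ (pow⇓ x) (comp⇓ (const⇓ 2 ∷ proj⇓ ∷ []) (mul⇓ 2 (2 ^ x)))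

iterated : ∀ {n} → PR 2 → ℕ → PR (suc n) → PR (suc n)
iterated op unit f =
  -- The step of `prec` receives the index, the accumulated value and the parameters; `f` must not
  -- see the accumulated value.
  prec (constant unit) (comp op (proj (# 1) ∷ comp f (proj zero ∷ projections (λ i → suc (suc i))) ∷ []))

∑⇓ : ∀ {n} {f : PR (suc n)} {F xs} → (∀ i → f ⟨ i ∷ xs ⟩⇓ F i) →
     ∀ b → iterated add 0 f ⟨ b ∷ xs ⟩⇓ ∑ b F
∑⇓ f⇓ zero    = prec⇓₀ (const⇓ 0)
∑⇓ f⇓ (suc b) = prec⇓₊ (∑⇓ f⇓ b)
  (comp⇓ (proj⇓ ∷ comp⇓ (proj⇓ ∷ projections⇓ _ (λ _ → refl)) (f⇓ b) ∷ []) (add⇓ _ _))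

∏⇓ : ∀ {n} {f : PR (suc n)} {F xs} → (∀ i → f ⟨ i ∷ xs ⟩⇓ F i) →
     ∀ b → iterated mul 1 f ⟨ b ∷ xs ⟩⇓ ∏ b F
∏⇓ f⇓ zero    = prec⇓₀ (const⇓ 1)
∏⇓ f⇓ (suc b) = prec⇓₊ (∏⇓ f⇓ b)
  (comp⇓ (proj⇓ ∷ comp⇓ (proj⇓ ∷ projections⇓ _ (λ _ → refl)) (f⇓ b) ∷ []) (mul⇓ _ _))

-- Terms for total recursive functions; in a sum or a product, variable 0 is
-- the index.  Predicates are represented by terms with 0 for truth, so that
-- addition is conjunction, ∑ᵉ and ∏ᵉ are the bounded quantifiers, m ∸ n says
-- m ≤ n, and mu searches for a true instance.
infixl 6 _+ᵉ_ _∸ᵉ_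
infixl 7 _*ᵉ_
data Exp (n : ℕ) : Set where
  var            : Fin n → Exp n
  lit            : ℕ → Exp n
  _+ᵉ_ _*ᵉ_ _∸ᵉ_ : Exp n → Exp n → Exp n
  2^ᵉ_           : Exp n → Exp n
  ∑ᵉ ∏ᵉ          : Exp n → Exp (suc n) → Exp n
  call           : ∀ {m} (f : PR m) (F : Vec ℕ m → ℕ) → (∀ xs → f ⟨ xs ⟩⇓ F xs) →
                   Vec (Exp n) m → Exp n

mutual
  ⟦_⟧ : ∀ {n} → Exp n → Vec ℕ n → ℕ
  ⟦ var i ⟧         xs = lookup xs i
  ⟦ lit c ⟧         xs = c
  ⟦ d +ᵉ e ⟧        xs = ⟦ d ⟧ xs + ⟦ e ⟧ xs
  ⟦ d *ᵉ e ⟧        xs = ⟦ d ⟧ xs * ⟦ e ⟧ xs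
  ⟦ d ∸ᵉ e ⟧        xs = ⟦ d ⟧ xs ∸ ⟦ e ⟧ xs
  ⟦ 2^ᵉ e ⟧         xs = 2 ^ ⟦ e ⟧ xs
  ⟦ ∑ᵉ b e ⟧        xs = ∑ (⟦ b ⟧ xs) (λ i → ⟦ e ⟧ (i ∷ xs))
  ⟦ ∏ᵉ b e ⟧        xs = ∏ (⟦ b ⟧ xs) (λ i → ⟦ e ⟧ (i ∷ xs))
  ⟦ call f F _ es ⟧ xs = F (⟦ es ⟧* xs)

  ⟦_⟧* : ∀ {m n} → Vec (Exp n) m → Vec ℕ n → Vec ℕ m
  ⟦ [] ⟧*     xs = []
  ⟦ e ∷ es ⟧* xs = ⟦ e ⟧ xs ∷ ⟦ es ⟧* xs

mutual
  compile : ∀ {n} → Exp n → PR n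
  compile (var i)         = proj i
  compile (lit c)         = constant c
  compile (d +ᵉ e)        = comp add (compile d ∷ compile e ∷ [])
  compile (d *ᵉ e)        = comp mul (compile d ∷ compile e ∷ [])
  compile (d ∸ᵉ e)        = comp sub (compile e ∷ compile d ∷ [])
  compile (2^ᵉ e)         = comp pow (compile e ∷ [])
  compile (∑ᵉ b e)        = comp (iterated add 0 (compile e)) (compile b ∷ projections id)
  compile (∏ᵉ b e)        = comp (iterated mul 1 (compile e)) (compile b ∷ projections id)
  compile (call f _ _ es) = comp f (compile* es)

  compile* : ∀ {m n} → Vec (Exp n) m → Vec (PR n) m
  compile* []       = []
  compile* (e ∷ es) = compile e ∷ compile* es

mutual
  compile⇓ : ∀ {n} (e : Exp n) xs → compile e ⟨ xs ⟩⇓ ⟦ e ⟧ xs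
  compile⇓ (var i)         xs = proj⇓
  compile⇓ (lit c)         xs = const⇓ c
  compile⇓ (d +ᵉ e)        xs = comp⇓ (compile⇓ d xs ∷ compile⇓ e xs ∷ []) (add⇓ _ _)
  compile⇓ (d *ᵉ e)        xs = comp⇓ (compile⇓ d xs ∷ compile⇓ e xs ∷ []) (mul⇓ _ _)
  compile⇓ (d ∸ᵉ e)        xs = comp⇓ (compile⇓ e xs ∷ compile⇓ d xs ∷ []) (sub⇓ _ _)
  compile⇓ (2^ᵉ e)         xs = comp⇓ (compile⇓ e xs ∷ []) (pow⇓ _)
  compile⇓ (∑ᵉ b e)        xs = comp⇓ (compile⇓ b xs ∷ projections⇓ id (λ _ → refl))
    (∑⇓ (λ i → compile⇓ e (i ∷ xs)) _)
  compile⇓ (∏ᵉ b e)        xs = comp⇓ (compile⇓ b xs ∷ projections⇓ id (λ _ → refl))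
    (∏⇓ (λ i → compile⇓ e (i ∷ xs)) _)
  compile⇓ (call f F f⇓ es) xs = comp⇓ (compile*⇓ es xs) (f⇓ _)

  compile*⇓ : ∀ {m n} (es : Vec (Exp n) m) xs → compile* es ⟨ xs ⟩⇓* ⟦ es ⟧* xs
  compile*⇓ []       xs = []
  compile*⇓ (e ∷ es) xs = compile⇓ e xs ∷ compile*⇓ es xs

-- Exp has no binding substitution, so a term is reused in another context by
-- calling its compiled form.
infix 8 _[_]ᵉ
_[_]ᵉ : ∀ {m n} → Exp m → Vec (Exp n) m → Exp n
e [ es ]ᵉ = call (compile e) ⟦ e ⟧ (compile⇓ e) es

infix 4 _≐ᵉ_
_≐ᵉ_ : ∀ {n} → Exp n → Exp n → Exp n
d ≐ᵉ e = (d ∸ᵉ e) +ᵉ (e ∸ᵉ d)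

dist≡0⇒≡ : ∀ a b → (a ∸ b) + (b ∸ a) ≡ 0 → a ≡ b
dist≡0⇒≡ a b eq = ≤-antisym (m∸n≡0⇒m≤n (m+n≡0⇒m≡0 (a ∸ b) eq)) (m∸n≡0⇒m≤n (m+n≡0⇒n≡0 (a ∸ b) eq))

≡⇒dist≡0 : ∀ {a b} → a ≡ b → (a ∸ b) + (b ∸ a) ≡ 0
≡⇒dist≡0 {a} refl rewrite n∸n≡0 a = refl

least-zero : ∀ (g : ℕ → ℕ) w → g w ≡ 0 →
             ∃[ m ] m ≤ w × g m ≡ 0 × (∀ j → j < m → ∃[ v ] g j ≡ suc v)
least-zero g zero    gw≡0 = 0 , z≤n , gw≡0 , λ _ ()
least-zero g (suc w) gw≡0 with g 0 in g0
... | zero = 0 , z≤n , g0 , λ _ ()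
... | suc v with least-zero (g ∘ suc) w gw≡0
...   | m , m≤w , gm≡0 , below = suc m , s≤s m≤w , gm≡0 , λ where
          zero    _         → v , g0
          (suc j) (s≤s j<m) → below j j<m

search : ∀ {n} (e : Exp (suc n)) {xs} w → ⟦ e ⟧ (w ∷ xs) ≡ 0 →
         ∃[ m ] m ≤ w × mu (compile e) ⟨ xs ⟩⇓ m × ⟦ e ⟧ (m ∷ xs) ≡ 0
search e {xs} w holds with least-zero (λ i → ⟦ e ⟧ (i ∷ xs)) w holds
... | m , m≤w , em≡0 , below = m , m≤w , mu⇓
        (λ j j<m → proj₁ (below j j<m) ,
                   subst (compile e ⟨ j ∷ xs ⟩⇓_) (proj₂ (below j j<m)) (compile⇓ e _))
        (subst (compile e ⟨ m ∷ xs ⟩⇓_) em≡0 (compile⇓ e _)) , em≡0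

∏≡0⇒∃ : ∀ n f → ∏ n f ≡ 0 → ∃[ i ] i < n × f i ≡ 0
∏≡0⇒∃ (suc n) f eq with m*n≡0⇒m≡0∨n≡0 (∏ n f) eq
... | inj₁ p with ∏≡0⇒∃ n f p
...   | i , i<n , fi≡0 = i , m<n⇒m<1+n i<n , fi≡0
∏≡0⇒∃ (suc n) f eq | inj₂ q = n , n<1+n n , q

∃⇒∏≡0 : ∀ n f {i} → i < n → f i ≡ 0 → ∏ n f ≡ 0
∃⇒∏≡0 (suc n) f {i} i<1+n fi≡0 with m≤n⇒m<n∨m≡n (s≤s⁻¹ i<1+n)
... | inj₁ i<n  = cong (_* f n) (∃⇒∏≡0 n f i<n fi≡0)
... | inj₂ refl = trans (cong (∏ n f *_) fi≡0) (*-zeroʳ (∏ n f))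

-- The search for a pair (t , i) with i < b t, where b and e see the variables
-- t ∷ xs and i ∷ t ∷ xs.
module PairSearch {n} (b : Exp (suc n)) (e : Exp (2 + n)) where
  abstract
    -- No pairing function is needed: the bounded quantifier makes the test on t total, so `outer`
    -- finds the least good t, and `inner` then finds the least i for it.
    outer inner : PR n
    outer = mu (compile (∏ᵉ b e))
    inner = comp (mu (compile e)) (outer ∷ projections id)

    pair-search : ∀ {xs} t i → i < ⟦ b ⟧ (t ∷ xs) → ⟦ e ⟧ (i ∷ t ∷ xs) ≡ 0 →
                  ∃[ t′ ] ∃[ i′ ] outer ⟨ xs ⟩⇓ t′ × inner ⟨ xs ⟩⇓ i′ ×
                  i′ < ⟦ b ⟧ (t′ ∷ xs) × ⟦ e ⟧ (i′ ∷ t′ ∷ xs) ≡ 0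
    pair-search {xs} t i i<b holds
      with search (∏ᵉ b e) t (∃⇒∏≡0 (⟦ b ⟧ (t ∷ xs)) (λ i → ⟦ e ⟧ (i ∷ t ∷ xs)) i<b holds)
    ... | t′ , _ , outer⇓ , holds′ with ∏≡0⇒∃ _ (λ i → ⟦ e ⟧ (i ∷ t′ ∷ xs)) holds′
    ...   | j , j<b , ej≡0 with search e j ej≡0
    ...     | i′ , i′≤j , inner⇓ , holds″ =
              t′ , i′ , outer⇓ ,
              comp⇓ (outer⇓ ∷ projections⇓ id (λ _ → refl)) inner⇓ ,
              ≤-<-trans i′≤j j<b , holds″

    -- Needed for prefix-freeness: a machine that starts with this search halts only on programs of
    -- the intended shape.
    outer-inverse : ∀ {xs t} → outer ⟨ xs ⟩⇓ t →
                    ∃[ i ] i < ⟦ b ⟧ (t ∷ xs) × ⟦ e ⟧ (i ∷ t ∷ xs) ≡ 0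
    outer-inverse {xs} {t} (mu⇓ _ at) =
      ∏≡0⇒∃ _ (λ i → ⟦ e ⟧ (i ∷ t ∷ xs)) (⇓-deterministic (compile⇓ (∏ᵉ b e) (t ∷ xs)) at)

-- Finite sums

∑-mono : ∀ n {f g} → (∀ i → i < n → f i ≤ g i) → ∑ n f ≤ ∑ n g
∑-mono zero    f≤g = z≤n
∑-mono (suc n) f≤g = +-mono-≤ (∑-mono n (λ i → f≤g i ∘ m<n⇒m<1+n)) (f≤g n (n<1+n n))

∑-cong : ∀ n {f g} → (∀ i → i < n → f i ≡ g i) → ∑ n f ≡ ∑ n g
∑-cong n f≡g = ≤-antisym (∑-mono n (λ i → ≤-reflexive ∘ f≡g i))
                         (∑-mono n (λ i → ≤-reflexive ∘ sym ∘ f≡g i))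

∑-+ : ∀ n f g → ∑ n (λ i → f i + g i) ≡ ∑ n f + ∑ n g
∑-+ zero    f g = refl
∑-+ (suc n) f g rewrite ∑-+ n f g = interchange (∑ n f) (∑ n g) (f n) (g n)
  where
  interchange : ∀ a b c d → a + b + (c + d) ≡ a + c + (b + d)
  interchange = solve-∀

∑-const : ∀ n c → ∑ n (λ _ → c) ≡ n * c
∑-const zero    c = refl
∑-const (suc n) c rewrite ∑-const n c = +-comm (n * c) c

*-∑ : ∀ c n f → c * ∑ n f ≡ ∑ n (λ i → c * f i)
*-∑ c zero    f = *-zeroʳ c
*-∑ c (suc n) f rewrite *-distribˡ-+ c (∑ n f) (f n) = cong (_+ c * f n) (*-∑ c n f)

∑-swap : ∀ m n (f : ℕ → ℕ → ℕ) → ∑ m (λ i → ∑ n (f i)) ≡ ∑ n (λ j → ∑ m (λ i → f i j))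
∑-swap zero    n f = sym (trans (∑-const n 0) (*-zeroʳ n))
∑-swap (suc m) n f rewrite ∑-swap m n f = sym (∑-+ n (λ j → ∑ m (λ i → f i j)) (f m))

∑-split : ∀ m n f → ∑ (m + n) f ≡ ∑ m f + ∑ n (λ i → f (m + i))
∑-split m zero    f rewrite +-identityʳ m = sym (+-identityʳ _)
∑-split m (suc n) f rewrite +-suc m n | ∑-split m n f = +-assoc (∑ m f) _ _

∑-blocks : ∀ m n f → ∑ (m * n) f ≡ ∑ m (λ i → ∑ n (λ j → f (i * n + j)))
∑-blocks zero    n f = refl
∑-blocks (suc m) n f rewrite +-comm n (m * n) | ∑-split (m * n) n f =
  cong (_+ ∑ n (λ j → f (m * n + j))) (∑-blocks m n f)

∑<⇒∃< : ∀ n f {β} → ∑ n f < n * β → ∃[ i ] i < n × f i < β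
∑<⇒∃< (suc n) f {β} lt with f n <? β
... | yes fn<β = n , n<1+n n , fn<β
... | no  fn≮β with ∑<⇒∃< n f (+-cancelʳ-< β (∑ n f) (n * β) (begin-strict
        ∑ n f + β    ≤⟨ +-monoʳ-≤ (∑ n f) (≮⇒≥ fn≮β) ⟩
        ∑ n f + f n  <⟨ lt ⟩
        β + n * β    ≡⟨ +-comm β (n * β) ⟩
        n * β + β    ∎))
  where open ≤-Reasoning
...   | i , i<n , fi<β = i , m<n⇒m<1+n i<n , fi<β

average : ∀ n f {β} → 0 < n → ∑ n f ≤ n * β → ∃[ i ] i < n × f i ≤ β
average n f {β} 0<n ≤nβ
  -- Over ℕ, at most β means below β + 1, and n > 0 makes the bound on the sum strict.
  with ∑<⇒∃< n f (≤-<-trans ≤nβ (*-monoʳ-< n {{>-nonZero 0<n}} (n<1+n β)))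
... | i , i<n , fi<1+β = i , i<n , s≤s⁻¹ fi<1+β

term≤∑ : ∀ {n} f {i} → i < n → f i ≤ ∑ n f
term≤∑ {suc n} f {i} i<1+n with m≤n⇒m<n∨m≡n (s≤s⁻¹ i<1+n)
... | inj₁ i<n  = m≤n⇒m≤n+o (f n) (term≤∑ f i<n)
... | inj₂ refl = m≤n+m (f n) (∑ n f)

∑≤1 : ∀ n f → (∀ i → i < n → f i ≤ 1) →
      (∀ i j → i < n → j < n → f i ≢ 0 → f j ≢ 0 → i ≡ j) → ∑ n f ≤ 1
∑≤1 zero    f f≤1 unique = z≤n
∑≤1 (suc n) f f≤1 unique with f n ≟ 0
... | yes fn≡0 rewrite fn≡0 | +-identityʳ (∑ n f) = ∑≤1 n f (λ i → f≤1 i ∘ m<n⇒m<1+n)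
        (λ i j i<n j<n → unique i j (m<n⇒m<1+n i<n) (m<n⇒m<1+n j<n))
... | no  fn≢0 = begin
        ∑ n f + f n           ≤⟨ +-mono-≤ (∑-mono n f≡0) (f≤1 n (n<1+n n)) ⟩
        ∑ n (λ _ → 0) + 1     ≡⟨ cong (_+ 1) (trans (∑-const n 0) (*-zeroʳ n)) ⟩
        1                     ∎
  where
  open ≤-Reasoning
  f≡0 : ∀ i → i < n → f i ≤ 0
  f≡0 i i<n with f i ≟ 0
  ... | yes fi≡0 = ≤-reflexive fi≡0
  ... | no  fi≢0 = ⊥-elim (<⇒≢ i<n (unique i n (m<n⇒m<1+n i<n) (n<1+n n) fi≢0 fn≢0))

-- The counting form of the pigeonhole principle: c is the indicator of a set
-- of numbers below n that g maps injectively to numbers below m.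
∑-injective : ∀ n m (c g : ℕ → ℕ) → (∀ i → i < n → c i ≤ 1) →
              (∀ i → i < n → c i ≢ 0 → g i < m) →
              (∀ i j → i < n → j < n → c i ≢ 0 → c j ≢ 0 → g i ≡ g j → i ≡ j) →
              ∑ n c ≤ m
∑-injective n m c g c≤1 g<m injective = begin
  ∑ n c                             ≤⟨ ∑-mono n c≤fibre ⟩
  ∑ n (λ i → ∑ m (fibre i))         ≡⟨ ∑-swap n m fibre ⟩
  ∑ m (λ p → ∑ n (λ i → fibre i p)) ≤⟨ ∑-mono m (λ p _ → ∑≤1 n _ (λ i → fibre≤1 i p) (unique p)) ⟩
  ∑ m (λ _ → 1)                     ≡⟨ trans (∑-const m 1) (*-identityʳ m) ⟩
  m                                 ∎
  where
  open ≤-Reasoning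
  -- Double counting: each member i of the set is counted over p = `g i`, and by injectivity at most
  -- one i lies over each p.
  fibre : ℕ → ℕ → ℕ
  fibre i p with g i ≟ p
  ... | yes _ = c i
  ... | no  _ = 0

  fibre-diagonal : ∀ i → fibre i (g i) ≡ c i
  fibre-diagonal i with g i ≟ g i
  ... | yes _   = refl
  ... | no  g≢g = ⊥-elim (g≢g refl)

  c≤fibre : ∀ i → i < n → c i ≤ ∑ m (fibre i)
  c≤fibre i i<n with c i ≟ 0
  ... | yes ci≡0 rewrite ci≡0 = z≤n
  ... | no  ci≢0 = ≤-trans (≤-reflexive (sym (fibre-diagonal i))) (term≤∑ (fibre i) (g<m i i<n ci≢0))

  fibre≤1 : ∀ i p → i < n → fibre i p ≤ 1
  fibre≤1 i p i<n with g i ≟ p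
  ... | yes _ = c≤1 i i<n
  ... | no  _ = z≤n

  fibre≢0 : ∀ i p → fibre i p ≢ 0 → c i ≢ 0 × g i ≡ p
  fibre≢0 i p ≢0 with g i ≟ p
  ... | yes gi≡p = ≢0 , gi≡p
  ... | no  _    = ⊥-elim (≢0 refl)

  unique : ∀ p i j → i < n → j < n → fibre i p ≢ 0 → fibre j p ≢ 0 → i ≡ j
  unique p i j i<n j<n fi≢0 fj≢0 with fibre≢0 i p fi≢0 | fibre≢0 j p fj≢0
  ... | ci≢0 , gi≡p | cj≢0 , gj≡p = injective i j i<n j<n ci≢0 cj≢0 (trans gi≡p (sym gj≡p))

-- mate R w a is w − a modulo R, for w, a < R.
mate : ℕ → ℕ → ℕ → ℕ
mate R w a = (w ∸ a) + (1 ∸ (1 ∸ (a ∸ w))) * ((w + R) ∸ a)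

mate-≤ : ∀ R {w a} → a ≤ w → mate R w a ≡ w ∸ a
mate-≤ R {w} {a} a≤w rewrite m≤n⇒m∸n≡0 a≤w = +-identityʳ (w ∸ a)

mate-> : ∀ R {w a} → w < a → mate R w a ≡ (w + R) ∸ a
mate-> R {w} {a} w<a rewrite m≤n⇒m∸n≡0 (<⇒≤ w<a) with a ∸ w in eq
... | zero  = ⊥-elim (<⇒≱ w<a (m∸n≡0⇒m≤n eq))
... | suc d rewrite 0∸n≡0 d = *-identityˡ (w + R ∸ a)

-- After a wrap-around the value exceeds w, so a second application of `mate` wraps again; this
-- gives the involution.
mate-wraps : ∀ R {w a} → w < a → a < R → w < mate R w a
mate-wraps R {w} {a} w<a a<R = begin-strict
  w           <⟨ m<m+n w (m<n⇒0<n∸m a<R) ⟩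
  w + (R ∸ a) ≡⟨ +-∸-assoc w (<⇒≤ a<R) ⟨
  w + R ∸ a   ≡⟨ mate-> R w<a ⟨
  mate R w a  ∎
  where open ≤-Reasoning

mate-involutive : ∀ {R w a} → a < R → mate R w (mate R w a) ≡ a
mate-involutive {R} {w} {a} a<R with a ≤? w
... | yes a≤w rewrite mate-≤ R a≤w | mate-≤ R (m∸n≤m w a) = m∸[m∸n]≡n a≤w
... | no  a≰w rewrite mate-> R (mate-wraps R (≰⇒> a≰w) a<R) | mate-> R (≰⇒> a≰w) =
        m∸[m∸n]≡n (≤-trans (<⇒≤ a<R) (m≤n+m R w))

-- With R = a + e, the indices w < a yield the residues from e on and the indices w ≥ a those below
-- e. So each residue is the mate of a for exactly one w.
∑-mate : ∀ {R a} f → a < R → ∑ R (λ w → f (mate R w a)) ≡ ∑ R f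
∑-mate {R} {a} f a<R with m≤n⇒∃[o]m+o≡n (<⇒≤ a<R)
... | e , refl = begin
  ∑ (a + e) (λ w → f (mate (a + e) w a))
    ≡⟨ ∑-split a e _ ⟩
  ∑ a (λ w → f (mate (a + e) w a)) + ∑ e (λ i → f (mate (a + e) (a + i) a))
    ≡⟨ cong₂ _+_ (∑-cong a λ w w<a → cong f (trans (mate-> (a + e) w<a) (wrap w)))
                 (∑-cong e λ i _ → cong f (trans (mate-≤ (a + e) (m≤m+n a i)) (m+n∸m≡n a i))) ⟩
  ∑ a (λ w → f (e + w)) + ∑ e f
    ≡⟨ +-comm (∑ a (λ w → f (e + w))) (∑ e f) ⟩
  ∑ e f + ∑ a (λ w → f (e + w))
    ≡⟨ ∑-split e a f ⟨
  ∑ (e + a) f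
    ≡⟨ cong (λ n → ∑ n f) (+-comm e a) ⟩
  ∑ (a + e) f ∎
  where
  open ≡-Reasoning
  wrap : ∀ w → w + (a + e) ∸ a ≡ e + w
  wrap w = trans (cong (_∸ a) (rearrange w a e)) (m+n∸m≡n a (e + w))
    where
    rearrange : ∀ w a e → w + (a + e) ≡ a + (e + w)
    rearrange = solve-∀

⨆ : ℕ → (ℕ → ℕ) → ℕ
⨆ zero    f = 0
⨆ (suc n) f = ⨆ n f ⊔ f n

term≤⨆ : ∀ {n} f {i} → i < n → f i ≤ ⨆ n f
term≤⨆ {suc n} f {i} i<1+n with m≤n⇒m<n∨m≡n (s≤s⁻¹ i<1+n)
... | inj₁ i<n  = m≤n⇒m≤n⊔o (f n) (term≤⨆ f i<n)
... | inj₂ refl = m≤n⊔m (⨆ n f) (f n)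

block-unique : ∀ {N q q′ r r′} → r < N → r′ < N → q * N + r ≡ q′ * N + r′ → q ≡ q′
block-unique {N} {q} {q′} {r} {r′} r<N r′<N eq =
  ≤-antisym (half r<N r′<N eq) (half r′<N r<N (sym eq))
  where
  open ≤-Reasoning
  half : ∀ {q q′ r r′} → r < N → r′ < N → q * N + r ≡ q′ * N + r′ → q ≤ q′
  half {q} {q′} {r} {r′} r<N r′<N eq = s≤s⁻¹ (*-cancelʳ-< N q (suc q′) (begin-strict
    q * N       ≤⟨ m≤m+n (q * N) r ⟩
    q * N + r   ≡⟨ eq ⟩
    q′ * N + r′ <⟨ +-monoʳ-< (q′ * N) r′<N ⟩
    q′ * N + N  ≡⟨ +-comm (q′ * N) N ⟩
    N + q′ * N  ∎))

-- Prefix-free programs and complexity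

increment : Str → Str
increment []          = false ∷ []
increment (false ∷ w) = true ∷ w
increment (true  ∷ w) = false ∷ increment w

decode : ℕ → Str
decode zero    = []
decode (suc n) = increment (decode n)

code-increment : ∀ w → code (increment w) ≡ suc (code w)
code-increment []          = refl
code-increment (false ∷ w) = refl
code-increment (true  ∷ w) rewrite code-increment w = cong suc (*-suc 2 (code w))

code-decode : ∀ n → code (decode n) ≡ n
code-decode zero    = refl
code-decode (suc n) = trans (code-increment (decode n)) (cong suc (code-decode n))

-- In binary, `suc (code w)` is a leading 1 followed by the digits of w, with the head of w least
-- significant.
2^length≤ : ∀ w → 2 ^ length w ≤ suc (code w)
2^length≤ []          = ≤-refl
2^length≤ (false ∷ w) = ≤-trans (*-monoʳ-≤ 2 (2^length≤ w)) (≤-reflexive (*-suc 2 (code w)))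
2^length≤ (true  ∷ w) =
  ≤-trans (*-monoʳ-≤ 2 (2^length≤ w)) (≤-trans (≤-reflexive (*-suc 2 (code w))) (n≤1+n _))

private
  double : ∀ c → suc (suc (2 + 2 * c)) ≡ 2 * suc (suc c)
  double = solve-∀

<2^1+length : ∀ w → suc (code w) < 2 ^ suc (length w)
<2^1+length []          = ≤-refl
<2^1+length (true  ∷ w) = ≤-trans (≤-reflexive (double (code w))) (*-monoʳ-≤ 2 (<2^1+length w))
<2^1+length (false ∷ w) = ≤-trans (≤-trans (n≤1+n _) (≤-reflexive (double (code w))))
                                  (*-monoʳ-≤ 2 (<2^1+length w))

code<2^ : ∀ {w L} → length w < L → code w < 2 ^ L
code<2^ {w} |w|<L = <-≤-trans (<-trans (n<1+n _) (<2^1+length w)) (^-monoʳ-≤ 2 |w|<L)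

binary-length-unique : ∀ {v a b} → 2 ^ a ≤ v → v < 2 ^ suc a → 2 ^ b ≤ v → v < 2 ^ suc b → a ≡ b
binary-length-unique la ua lb ub = ≤-antisym (half la ub) (half lb ua)
  where
  half : ∀ {v a b} → 2 ^ a ≤ v → v < 2 ^ suc b → a ≤ b
  half {v} {a} {b} l u with a ≤? b
  ... | yes a≤b = a≤b
  ... | no  a≰b = ⊥-elim (<-irrefl refl (<-≤-trans u (≤-trans (^-monoʳ-≤ 2 (≰⇒> a≰b)) l)))

program : ℕ → Str → Str
program zero    q = false ∷ q
program (suc k) q = true ∷ program k q

length-program : ∀ k q → length (program k q) ≡ suc (k + length q)
length-program zero    q = refl
length-program (suc k) q = cong suc (length-program k q)

program-prefix : ∀ k q {k′ q′} r → program k q ++ r ≡ program k′ q′ → k ≡ k′ × q ++ r ≡ q′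
program-prefix zero    q {zero}   r eq = refl , ∷-injectiveʳ eq
program-prefix (suc k) q {suc k′} r eq with program-prefix k q r (∷-injectiveʳ eq)
... | k≡k′ , eq′ = cong suc k≡k′ , eq′

private
  code-0 : ∀ c → 1 + 2 * c + 2 ≡ 2 * suc c + 1
  code-0 = solve-∀

  code-1 : ∀ c → 2 + 2 * c + 2 ≡ 2 * (c + 2)
  code-1 = solve-∀

  2D+1≢1 : ∀ D .{{_ : NonZero D}} → 2 * D + 1 ≢ 1
  2D+1≢1 (suc D) eq with () ← +-cancelʳ-≡ 1 (2 * suc D) 0 eq

  2m≢2n+1 : ∀ m n → 2 * m ≢ 2 * n + 1
  2m≢2n+1 m n eq = even≢odd m n (trans eq (+-comm (2 * n) 1))

-- After adding 2, each leading `true` is a factor 2 and the first `false` leaves an odd factor.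
-- Thus k is the exponent of 2, and parsing is arithmetic.
code-program : ∀ k q → code (program k q) + 2 ≡ 2 ^ k * (2 * suc (code q) + 1)
code-program zero    q = trans (code-0 (code q)) (sym (*-identityˡ _))
code-program (suc k) q = trans (code-1 (code (program k q)))
  (trans (cong (2 *_) (code-program k q)) (sym (*-assoc 2 (2 ^ k) _)))

-- Parity decides each digit. `NonZero D` excludes the strings without `false`, whose codes plus 2
-- are powers of 2.
parse : ∀ k p D .{{_ : NonZero D}} → code p + 2 ≡ 2 ^ k * (2 * D + 1) →
        ∃[ q ] p ≡ program k q × suc (code q) ≡ D
parse zero [] D eq = ⊥-elim (2m≢2n+1 1 D (trans eq (*-identityˡ _)))
parse zero (false ∷ q) D eq = q , refl , *-cancelˡ-≡ (suc (code q)) D 2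
  (+-cancelʳ-≡ 1 _ _ (trans (sym (code-0 (code q))) (trans eq (*-identityˡ _))))
parse zero (true ∷ q) D eq =
  ⊥-elim (2m≢2n+1 (code q + 2) D (trans (sym (code-1 (code q))) (trans eq (*-identityˡ _))))
parse (suc k) p D eq with trans eq (*-assoc 2 (2 ^ k) (2 * D + 1))
parse (suc k) [] D eq | even =
  ⊥-elim (2D+1≢1 D (m*n≡1⇒n≡1 (2 ^ k) (2 * D + 1) (sym (*-cancelˡ-≡ 1 _ 2 even))))
parse (suc k) (false ∷ q) D eq | even =
  ⊥-elim (2m≢2n+1 (2 ^ k * (2 * D + 1)) (suc (code q)) (trans (sym even) (code-0 (code q))))
parse (suc k) (true ∷ q) D eq | even
  with parse k q D (*-cancelˡ-≡ _ _ 2 (trans (sym (code-1 (code q))) even))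
... | r , q≡ , eq′ = r , cong (true ∷_) q≡ , eq′

-- The programs are the strings 1ᵏ0q with |q| = Ck; with d = code q + 1 − 2^(Ck)
-- they are recognised by the equation code p + 2 = 2ᵏ(2(2^(Ck) + d) + 1).
module PaddedMachine (C : ℕ) (o : PR 3) where

  private
    bound : Exp 3
    bound = 2^ᵉ (lit C *ᵉ var (# 0))

    -- The variables are d ∷ k ∷ code p ∷ y, without d in `bound`.
    parses : Exp 4
    parses = var (# 2) +ᵉ lit 2 ≐ᵉ
      2^ᵉ var (# 1) *ᵉ (lit 2 *ᵉ (2^ᵉ (lit C *ᵉ var (# 1)) +ᵉ var (# 0)) +ᵉ lit 1)

    open PairSearch bound parses

  machine : Machine
  machine = comp o (outer ∷ inner ∷ proj (# 1) ∷ [])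

  private
    parsed : ∀ p {y} k d → d < 2 ^ (C * k) → ⟦ parses ⟧ (d ∷ k ∷ code p ∷ y ∷ []) ≡ 0 →
             ∃[ q ] p ≡ program k q × length q ≡ C * k × suc (code q) ≡ 2 ^ (C * k) + d
    parsed p k d d< holds
      with parse k p (2 ^ (C * k) + d) {{>-nonZero (<-≤-trans (m^n>0 2 (C * k)) (m≤m+n _ d))}} (dist≡0⇒≡ _ _ holds)
    ... | q , p≡ , q≡ = q , p≡ , binary-length-unique (2^length≤ q) (<2^1+length q)
      (≤-trans (m≤m+n _ d) (≤-reflexive (sym q≡)))
      (begin-strict
        suc (code q)                ≡⟨ q≡ ⟩
        2 ^ (C * k) + d             <⟨ +-monoʳ-< (2 ^ (C * k)) d< ⟩
        2 ^ (C * k) + 2 ^ (C * k)   ≡⟨ cong (2 ^ (C * k) +_) (+-identityʳ _) ⟨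
        2 ^ suc (C * k)             ∎) , q≡
      where open ≤-Reasoning

    halting-program : ∀ {p y} → Halts machine p y → ∃[ k ] ∃[ q ] p ≡ program k q × length q ≡ C * k
    halting-program {p} {y} (_ , comp⇓ (_∷_ {v = k} k⇓ _) _) with outer-inverse k⇓
    ... | d , d< , holds with parsed p {code y} k d d< holds
    ...   | q , p≡ , |q|≡ , _ = k , q , p≡ , |q|≡

  machine-prefixFree : PrefixFree machine
  machine-prefixFree y p r h h′ with halting-program {p} {y} h | halting-program {p ++ r} {y} h′
  -- The unary part fixes k, and then both remainders have length Ck, which leaves nothing for r.
  ... | k , q , refl , |q|≡ | k′ , q′ , eq , |q′|≡ with program-prefix k q r eq
  ...   | refl , refl = length≡0 r (+-cancelˡ-≡ (length q) (length r) 0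
          (trans (sym (length-++ q)) (trans |q′|≡ (trans (sym |q|≡) (sym (+-identityʳ _))))))
    where
    length≡0 : ∀ (r : Str) → length r ≡ 0 → r ≡ []
    length≡0 [] _ = refl

  machine-outputs : ∀ {k d y x} → d < 2 ^ (C * k) → o ⟨ k ∷ d ∷ y ∷ [] ⟩⇓ x →
    ∃[ p ] length p ≡ suc (k + C * k) × Outputs machine p (decode y) (decode x)
  machine-outputs {k} {d} {y} {x} d< o⇓ = p , trans (length-program k q) (cong (λ l → suc (k + l)) |q|≡) , output
    where
    -- The summand 2^(Ck) is the leading 1, which pads d to exactly Ck digits.
    v = 2 ^ (C * k) + d
    0<v : 0 < v
    0<v = <-≤-trans (m^n>0 2 (C * k)) (m≤m+n _ d)
    q = decode (pred v)
    p = program k q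
    q≡ : suc (code q) ≡ v
    q≡ = trans (cong suc (code-decode (pred v))) (suc-pred v {{>-nonZero 0<v}})
    holds₀ : ⟦ parses ⟧ (d ∷ k ∷ code p ∷ y ∷ []) ≡ 0
    holds₀ = ≡⇒dist≡0 (trans (code-program k q) (cong (λ D → 2 ^ k * (2 * D + 1)) q≡))
    |q|≡ : length q ≡ C * k
    |q|≡ with parsed p {y} k d d< holds₀
    ... | q′ , p≡ , |q′|≡ , _ with program-prefix k q [] (trans (++-identityʳ p) p≡)
    ...   | _ , refl = trans (cong length (sym (++-identityʳ q))) |q′|≡
    output : machine ⟨ code p ∷ code (decode y) ∷ [] ⟩⇓ code (decode x)
    output rewrite code-decode y | code-decode x with pair-search k d d< holds₀
    -- The search might find another pair; uniqueness of the parse shows that it finds k and d.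
    ... | k′ , d′ , k⇓ , d⇓ , d′< , holds′ with parsed p {y} k′ d′ d′< holds′
    ...   | q′ , p≡ , _ , q′≡ with program-prefix k q [] (trans (++-identityʳ p) p≡)
    ...     | refl , eq with trans (sym q≡) (trans (cong (suc ∘ code) (trans (sym (++-identityʳ q)) eq)) q′≡)
    ...       | vv = comp⇓ (k⇓ ∷ subst (inner ⟨ _ ⟩⇓_) (sym (+-cancelˡ-≡ _ d d′ vv)) d⇓ ∷ proj⇓ ∷ []) o⇓

-- The indicator of n < L, as a number so that sums of it count.
below : ℕ → ℕ → ℕ
below L n = 1 ∸ (suc n ∸ L)

below≡0 : ∀ {L n} → L ≤ n → below L n ≡ 0
below≡0 {L} {n} L≤n rewrite +-∸-assoc 1 L≤n = 0∸n≡0 (n ∸ L)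

below≢0 : ∀ {L n} → below L n ≢ 0 → n < L
below≢0 {L} {n} ≢0 with n <? L
... | yes n<L = n<L
... | no  n≮L = ⊥-elim (≢0 (below≡0 {L} {n} (≮⇒≥ n≮L)))

below≡1 : ∀ {L n} → n < L → below L n ≡ 1
below≡1 n<L rewrite m≤n⇒m∸n≡0 n<L = refl

module Complexity (U : Machine) (prefixFree-U : PrefixFree U) (universal-U : Universal U)
                  (K : Str → Str → ℕ) (K-complexity : IsComplexityOf U K) where

  κ : ℕ → ℕ → ℕ
  κ x y = K (decode x) (decode y)

  private
    -- Once k exceeds the length of the simulation prefix ρ, that prefix and the k + 1 symbols of
    -- the unary part fit into the allowance 3k. Positive length is recorded for `κ₀-positive`.
    describe-by : ∀ C o → ∃[ k₀ ] (∀ {k d y x} → k₀ ≤ k → d < 2 ^ (C * k) →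
                  o ⟨ k ∷ d ∷ y ∷ [] ⟩⇓ x →
                  ∃[ p ] 0 < length p × length p ≤ C * k + 3 * k × Outputs U p (decode y) (decode x))
    describe-by C o with universal-U machine machine-prefixFree
      where open PaddedMachine C o
    ... | ρ , simulates = suc (length ρ) , describe
      where
      open PaddedMachine C o
      describe : ∀ {k d y x} → suc (length ρ) ≤ k → d < 2 ^ (C * k) → o ⟨ k ∷ d ∷ y ∷ [] ⟩⇓ x →
                 ∃[ p ] 0 < length p × length p ≤ C * k + 3 * k × Outputs U p (decode y) (decode x)
      describe {k} {d} {y} {x} ρ<k d< o⇓ with machine-outputs {k} {d} {y} {x} d< o⇓
      ... | p , |p|≡ , output = ρ ++ p , 0< , ≤3k ,
              Equivalence.from (simulates p (decode y) (decode x)) output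
        where
        |ρp|≡ : length (ρ ++ p) ≡ length ρ + suc (k + C * k)
        |ρp|≡ = trans (length-++ ρ) (cong (length ρ +_) |p|≡)
        0< : 0 < length (ρ ++ p)
        0< rewrite |ρp|≡ = <-≤-trans z<s (m≤n+m _ (length ρ))
        ≤3k : length (ρ ++ p) ≤ C * k + 3 * k
        ≤3k rewrite |ρp|≡ = begin
          length ρ + suc (k + C * k)  ≡⟨ +-suc (length ρ) _ ⟩
          suc (length ρ) + (k + C * k) ≤⟨ +-monoˡ-≤ (k + C * k) ρ<k ⟩
          k + (k + C * k)             ≤⟨ m≤m+n _ k ⟩
          k + (k + C * k) + k         ≡⟨ rearrange k (C * k) ⟩
          C * k + 3 * k               ∎
          where
          open ≤-Reasoning
          rearrange : ∀ k c → k + (k + c) + k ≡ c + 3 * k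
          rearrange = solve-∀

  describe : ∀ C o → ∃[ k₀ ] (∀ {k d y x} → k₀ ≤ k → d < 2 ^ (C * k) →
             o ⟨ k ∷ d ∷ y ∷ [] ⟩⇓ x → κ x y ≤ C * k + 3 * k)
  describe C o with describe-by C o
  ... | k₀ , by = k₀ , λ {k} {d} {y} {x} k₀≤k d< o⇓ → let (p , _ , |p|≤ , output) = by {k} {d} {y} {x} k₀≤k d< o⇓ in
        ≤-trans (proj₂ (K-complexity (decode x) (decode y)) p output) |p|≤

  -- If the empty program halted on the empty condition, prefix-freeness would forbid any other
  -- halting program there; but simulating a padded machine gives a nonempty one.
  κ₀-positive : ∀ x → 0 < κ x 0
  κ₀-positive x with κ x 0 | K-complexity (decode x) []
  ... | suc _ | _ = z<s
  ... | zero  | ([] , output , _) , _ with describe-by 0 (proj (# 0))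
  ...   | k₀ , by with by {k₀} {0} {0} {k₀} ≤-refl (s≤s z≤n) proj⇓
  ...     | p , 0<|p| , _ , output′ with refl ← prefixFree-U [] [] p (decode x , output) (decode k₀ , output′) =
            ⊥-elim (n≮0 0<|p|)
  κ₀-positive x | zero | (_ ∷ _ , _ , ()) , _

  -- The shortest programs of the numbers counted have codes below 2^L, and since U is deterministic
  -- different numbers have different programs.
  incompressible : ∀ n b y L → ∑ n (λ i → below L (κ (b + i) y)) ≤ 2 ^ L
  incompressible n b y L = ∑-injective n (2 ^ L) _ (λ i → code (shortest i))
    (λ i _ → m∸n≤m 1 (suc (κ (b + i) y) ∸ L))
    (λ i _ short → code<2^ {shortest i} (<-≤-trans (≤-reflexive (cong suc (|shortest| i))) (below≢0 {L} short)))
    (λ i j _ _ _ _ eq → +-cancelˡ-≡ b i j (same-output i j eq))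
    where
    shortest : ℕ → Str
    shortest i = proj₁ (proj₁ (K-complexity (decode (b + i)) (decode y)))
    |shortest| : ∀ i → length (shortest i) ≡ κ (b + i) y
    |shortest| i = proj₂ (proj₂ (proj₁ (K-complexity (decode (b + i)) (decode y))))
    output : ∀ i → Outputs U (shortest i) (decode y) (decode (b + i))
    output i = proj₁ (proj₂ (proj₁ (K-complexity (decode (b + i)) (decode y))))
    same-output : ∀ i j → code (shortest i) ≡ code (shortest j) → b + i ≡ b + j
    same-output i j eq = trans (sym (code-decode (b + i))) (trans
      (⇓-deterministic (output i) (subst (λ c → U ⟨ c ∷ _ ∷ [] ⟩⇓ _) (sym eq) (output j)))
      (code-decode (b + j)))

-- Rational values

-- Events compare f with ½. The distance itself will be at least ¾ or at most ¼, so that a value of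
-- f within ¼ of it is strictly on the right side.
¼ ½ ¾ : ℚ
¼ = pos 1 / 4
½ = pos 1 / 2
¾ = pos 3 / 4

fromℚᵘ-mono-< : ∀ {p q} → p ℚᵘ.< q → fromℚᵘ p ℚ.< fromℚᵘ q
fromℚᵘ-mono-< {p} {q} p<q = ℚ.toℚᵘ-cancel-<
  (ℚᵘ.<-respˡ-≃ (ℚᵘ.≃-sym (ℚ.toℚᵘ-fromℚᵘ p)) (ℚᵘ.<-respʳ-≃ (ℚᵘ.≃-sym (ℚ.toℚᵘ-fromℚᵘ q)) p<q))

fromℚᵘ-mono-≤ : ∀ {p q} → p ℚᵘ.≤ q → fromℚᵘ p ℚ.≤ fromℚᵘ q
fromℚᵘ-mono-≤ {p} {q} p≤q = ℚ.toℚᵘ-cancel-≤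
  (ℚᵘ.≤-respˡ-≃ (ℚᵘ.≃-sym (ℚ.toℚᵘ-fromℚᵘ p)) (ℚᵘ.≤-respʳ-≃ (ℚᵘ.≃-sym (ℚ.toℚᵘ-fromℚᵘ q)) p≤q))

private
  ⊖-double : ∀ α β → (α ⊖ β) ℤ.* pos 2 ≡ 2 * α ⊖ 2 * β
  ⊖-double α β = begin
    (α ⊖ β) ℤ.* pos 2
      ≡⟨ cong (ℤ._* pos 2) (ℤ.m-n≡m⊖n α β) ⟨
    (pos α ℤ.- pos β) ℤ.* pos 2
      ≡⟨ ℤ.*-distribʳ-+ (pos 2) (pos α) (ℤ.- pos β) ⟩
    pos α ℤ.* pos 2 ℤ.+ (ℤ.- pos β) ℤ.* pos 2
      ≡⟨ cong₂ ℤ._+_ (ℤ.*-comm (pos α) (pos 2))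
           (trans (sym (ℤ.neg-distribˡ-* (pos β) (pos 2))) (cong ℤ.-_ (ℤ.*-comm (pos β) (pos 2)))) ⟩
    pos 2 ℤ.* pos α ℤ.- pos 2 ℤ.* pos β
      ≡⟨ cong₂ ℤ._-_ (ℤ.pos-* 2 α) (ℤ.pos-* 2 β) ⟨
    pos (2 * α) ℤ.- pos (2 * β)
      ≡⟨ ℤ.m-n≡m⊖n (2 * α) (2 * β) ⟩
    2 * α ⊖ 2 * β ∎
    where open ≡-Reasoning

  1*≡⊖ : ∀ b c → pos 1 ℤ.* pos c ≡ (b + c) ⊖ b
  1*≡⊖ b c = trans (ℤ.*-identityˡ (pos c))
    (sym (trans (cong ((b + c) ⊖_) (sym (+-identityʳ b))) (ℤ.+-cancelˡ-⊖ b c 0)))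

  above-u : ∀ {α β γ} → 2 * β + suc γ < 2 * α → mkℚᵘ (pos 1) 1 ℚᵘ.< mkℚᵘ (α ⊖ β) γ
  above-u {α} {β} {γ} lt =
    ℚᵘ.*<* (subst₂ ℤ._<_ (sym (1*≡⊖ (2 * β) (suc γ))) (sym (⊖-double α β)) (ℤ.⊖-monoˡ-< (2 * β) lt))
  above-u≤ : ∀ {α β γ} → 2 * β + suc γ ≤ 2 * α → mkℚᵘ (pos 1) 1 ℚᵘ.≤ mkℚᵘ (α ⊖ β) γ
  above-u≤ {α} {β} {γ} le =
    ℚᵘ.*≤* (subst₂ ℤ._≤_ (sym (1*≡⊖ (2 * β) (suc γ))) (sym (⊖-double α β)) (ℤ.⊖-monoˡ-≤ (2 * β) le))
  below-u : ∀ {α β γ} → 2 * α < 2 * β + suc γ → mkℚᵘ (α ⊖ β) γ ℚᵘ.< mkℚᵘ (pos 1) 1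
  below-u {α} {β} {γ} lt =
    ℚᵘ.*<* (subst₂ ℤ._<_ (sym (⊖-double α β)) (sym (1*≡⊖ (2 * β) (suc γ))) (ℤ.⊖-monoˡ-< (2 * β) lt))
  below-u≤ : ∀ {α β γ} → 2 * α ≤ 2 * β + suc γ → mkℚᵘ (α ⊖ β) γ ℚᵘ.≤ mkℚᵘ (pos 1) 1
  below-u≤ {α} {β} {γ} le =
    ℚᵘ.*≤* (subst₂ ℤ._≤_ (sym (⊖-double α β)) (sym (1*≡⊖ (2 * β) (suc γ))) (ℤ.⊖-monoˡ-≤ (2 * β) le))

-- Clearing the denominator and moving β across gives a comparison of naturals, which a program can
-- test.
½<⊖/ : ∀ {α β γ} → 2 * β + suc γ < 2 * α → ½ ℚ.< (α ⊖ β) / suc γ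
½<⊖/ {α} {β} {γ} lt = fromℚᵘ-mono-< {mkℚᵘ (pos 1) 1} (above-u {α} {β} {γ} lt)

⊖/<½ : ∀ {α β γ} → 2 * α < 2 * β + suc γ → (α ⊖ β) / suc γ ℚ.< ½
⊖/<½ {α} {β} {γ} lt = fromℚᵘ-mono-< {_} {mkℚᵘ (pos 1) 1} (below-u {α} {β} {γ} lt)

½<⊖/⁻¹ : ∀ {α β γ} → ½ ℚ.< (α ⊖ β) / suc γ → 2 * β + suc γ < 2 * α
½<⊖/⁻¹ {α} {β} {γ} lt = ≰⇒> λ le →
  ℚ.<-irrefl refl (ℚ.<-≤-trans lt (fromℚᵘ-mono-≤ {_} {mkℚᵘ (pos 1) 1} (below-u≤ {α} {β} {γ} le)))

⊖/<½⁻¹ : ∀ {α β γ} → (α ⊖ β) / suc γ ℚ.< ½ → 2 * α < 2 * β + suc γ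
⊖/<½⁻¹ {α} {β} {γ} lt = ≰⇒> λ le →
  ℚ.<-irrefl refl (ℚ.<-≤-trans lt (fromℚᵘ-mono-≤ {mkℚᵘ (pos 1) 1} (above-u≤ {α} {β} {γ} le)))

module _ (K : Str → Str → ℕ) where
  open Distance K using (ratio)

  ¾≤ratio : ∀ {a b} → 0 < b → 3 * b ≤ 4 * a → ¾ ℚ.≤ ratio a b
  ¾≤ratio {a} {suc b} _ le = fromℚᵘ-mono-≤ {mkℚᵘ (pos 3) 3} {mkℚᵘ (pos a) b} (ℚᵘ.*≤*
    (subst₂ ℤ._≤_ (ℤ.pos-* 3 (suc b)) (trans (cong pos (*-comm 4 a)) (ℤ.pos-* a 4)) (ℤ.+≤+ le)))

  ratio≤¼ : ∀ {a b} → 0 < b → 4 * a ≤ b → ratio a b ℚ.≤ ¼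
  ratio≤¼ {a} {suc b} _ le = fromℚᵘ-mono-≤ {mkℚᵘ (pos a) b} {mkℚᵘ (pos 1) 3} (ℚᵘ.*≤*
    (subst₂ ℤ._≤_ (trans (cong pos (*-comm 4 a)) (ℤ.pos-* a 4)) (sym (ℤ.*-identityˡ (pos (suc b)))) (ℤ.+≤+ le)))

0<¼ : 0ℚ ℚ.< ¼
0<¼ = ℚ.*<* (ℤ.+<+ (s≤s z≤n))

private
  +-cancel-minus : ∀ p q → (p ℚ.- q) ℚ.+ q ≡ p
  +-cancel-minus p q = trans (ℚ.+-assoc p (ℚ.- q) q)
    (trans (cong (p ℚ.+_) (ℚ.+-inverseˡ q)) (ℚ.+-identityʳ p))

  p≤∣p∣ : ∀ p → p ℚ.≤ ℚ.∣ p ∣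
  p≤∣p∣ p with ℚ.≤-total 0ℚ p
  ... | inj₁ 0≤p = ℚ.≤-reflexive (sym (ℚ.0≤p⇒∣p∣≡p 0≤p))
  ... | inj₂ p≤0 = ℚ.≤-trans p≤0 (ℚ.0≤∣p∣ p)

  neg-minus : ∀ p q → ℚ.- (p ℚ.- q) ≡ q ℚ.- p
  neg-minus p q = trans (ℚ.neg-distrib-+ p (ℚ.- q))
    (trans (ℚ.+-comm (ℚ.- p) (ℚ.- (ℚ.- q))) (cong (ℚ._- p) (⁻¹-involutive ℚ.+-0-group q)))

  near-bound : ∀ {p q r} → ℚ.∣ p ℚ.- q ∣ ℚ.< ¼ → q ℚ.≤ r → p ℚ.< ¼ ℚ.+ r
  near-bound {p} {q} {r} near q≤r = subst (ℚ._< ¼ ℚ.+ r) (+-cancel-minus p q)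
    (ℚ.+-mono-<-≤ (ℚ.≤-<-trans (p≤∣p∣ (p ℚ.- q)) near) q≤r)

near-≤¼ : ∀ {p q} → ℚ.∣ p ℚ.- q ∣ ℚ.< ¼ → q ℚ.≤ ¼ → p ℚ.< ½
near-≤¼ {p} {q} = near-bound {p} {q}

near-≥¾ : ∀ {p q} → ℚ.∣ p ℚ.- q ∣ ℚ.< ¼ → ¾ ℚ.≤ q → ½ ℚ.< p
near-≥¾ {p} {q} near ¾≤q = ℚ.≰⇒> λ p≤½ → ℚ.<-irrefl refl (ℚ.<-≤-trans
  (near-bound {q} {p} (subst (ℚ._< ¼) (trans (sym (ℚ.∣-p∣≡∣p∣ (p ℚ.- q))) (cong ℚ.∣_∣ (neg-minus p q))) near) p≤½) ¾≤q)

-- Oscillations of Σₙ- and Πₙ-approximations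

Along : Direction → ℚ → ℚ → Set
Along up   p q = p ℚ.≤ q
Along down p q = q ℚ.≤ p

MonotoneBelow : Direction → ℕ → (ℕ → ℚ) → Set
MonotoneBelow d b g = ∀ t → suc t < b → Along d (g t) (g (suc t))

Along-trans : ∀ d {p q r} → Along d p q → Along d q r → Along d p r
Along-trans up   p≤q q≤r = ℚ.≤-trans p≤q q≤r
Along-trans down q≤p r≤q = ℚ.≤-trans r≤q q≤p

Along-refl : ∀ d {p} → Along d p p
Along-refl up   = ℚ.≤-refl
Along-refl down = ℚ.≤-refl

monotone : ∀ d {b g s t} → MonotoneBelow d b g → s ≤ t → t < b → Along d (g s) (g t)
monotone d {b} {g} {s} {t} mono s≤t t<b with m≤n⇒m<n∨m≡n s≤t
... | inj₂ refl = Along-refl d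
monotone d {b} {g} {s} {suc t} mono _ t<b | inj₁ s<1+t =
  Along-trans d (monotone d {b} {g} mono (s≤s⁻¹ s<1+t) (<-trans (n<1+n t) t<b)) (mono t t<b)

-- Of two moves in opposite directions, one goes against the direction e of the monotone segment.
no-turn : ∀ d e {b g s t u} → MonotoneBelow e b g → s < t → t < u → u < b →
          Moves d (g s) (g t) → ¬ Moves (opposite d) (g t) (g u)
no-turn up up {b} {g} mono s<t t<u u<b m₁ m₂ =
  ℚ.<-irrefl refl (ℚ.<-≤-trans m₂ (monotone up {b} {g} mono (<⇒≤ t<u) u<b))
no-turn up down {b} {g} mono s<t t<u u<b m₁ m₂ =
  ℚ.<-irrefl refl (ℚ.<-≤-trans m₁ (monotone down {b} {g} mono (<⇒≤ s<t) (<-trans t<u u<b)))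
no-turn down up {b} {g} mono s<t t<u u<b m₁ m₂ =
  ℚ.<-irrefl refl (ℚ.<-≤-trans m₁ (monotone up {b} {g} mono (<⇒≤ s<t) (<-trans t<u u<b)))
no-turn down down {b} {g} mono s<t t<u u<b m₁ m₂ =
  ℚ.<-irrefl refl (ℚ.<-≤-trans m₂ (monotone down {b} {g} mono (<⇒≤ t<u) u<b))

Zigzag-shift : ∀ c {g d s k} → c ≤ s → Zigzag g d s k → Zigzag (λ t → g (c + t)) d (s ∸ c) k
Zigzag-shift c {g} {d} c≤s (move {t = t} s<t m) = move (∸-monoˡ-< s<t c≤s)
  (subst₂ (λ i j → Moves d (g i) (g j)) (sym (m+[n∸m]≡n c≤s)) (sym (m+[n∸m]≡n (≤-trans c≤s (<⇒≤ s<t)))) m)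
Zigzag-shift c {g} {d} c≤s (turn s<t m z) = turn (∸-monoˡ-< s<t c≤s)
  (subst₂ (λ i j → Moves d (g i) (g j)) (sym (m+[n∸m]≡n c≤s)) (sym (m+[n∸m]≡n c≤t)) m)
  (Zigzag-shift c c≤t z)
  where c≤t = ≤-trans c≤s (<⇒≤ s<t)

-- By `no-turn` the first two moves cannot both end before time c. The rest of the zigzag therefore
-- starts at c or later and survives the shift.
Zigzag-monotone-start : ∀ e {c g d s k} → MonotoneBelow e c g → Zigzag g d s (2 + k) →
                        ∃[ d′ ] ∃[ s′ ] Zigzag (λ t → g (c + t)) d′ s′ k
Zigzag-monotone-start e {c} {g} {d} mono (turn s<t m₁ (turn {t = u} t<u m₂ z)) with u <? c
... | yes u<c = ⊥-elim (no-turn d e {c} {g} mono s<t t<u u<c m₁ m₂)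
... | no  u≮c = _ , _ , Zigzag-shift c (≮⇒≥ u≮c) z

monotone⇒no-Zigzag : ∀ e {g d s} → (∀ b → MonotoneBelow e b g) → ¬ Zigzag g d s 1
monotone⇒no-Zigzag e {g} {d} mono (turn s<t m₁ (move {t = u} t<u m₂)) =
  no-turn d e {suc u} {g} (mono (suc u)) s<t t<u (n<1+n u) m₁ m₂

-- Each phase allows two turns: its own reversal and the unconstrained step
-- into the next phase.
oscillations : ℕ → ℕ
oscillations zero    = 0
oscillations (suc n) = 2 + oscillations n

mutual
  ΣSequence⇒oscillations : ∀ n {g} → ΣSequence (suc n) g → OscillationsAtMost (oscillations n) g
  ΣSequence⇒oscillations zero    mono d s = monotone⇒no-Zigzag up (λ _ t _ → mono t)
  ΣSequence⇒oscillations (suc n) (c , mono , rest) d s z with Zigzag-monotone-start up mono z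
  ... | d′ , s′ , z′ = ΠSequence⇒oscillations n rest d′ s′ z′

  ΠSequence⇒oscillations : ∀ n {g} → ΠSequence (suc n) g → OscillationsAtMost (oscillations n) g
  ΠSequence⇒oscillations zero    mono d s = monotone⇒no-Zigzag down (λ _ t _ → mono t)
  ΠSequence⇒oscillations (suc n) (c , mono , rest) d s z with Zigzag-monotone-start down mono z
  ... | d′ , s′ , z′ = ΣSequence⇒oscillations n rest d′ s′ z′

-- The pursuit of many events

dir : ℕ → Direction
dir zero    = up
dir (suc j) = opposite (dir j)

Beyond : Direction → ℚ → Set
Beyond up   q = ½ ℚ.< q
Beyond down q = q ℚ.< ½

Settled : Direction → ℚ → Set
Settled up   q = ¾ ℚ.≤ q
Settled down q = q ℚ.≤ ¼

Settled⇒Beyond : ∀ d {p q} → Settled d q → ℚ.∣ p ℚ.- q ∣ ℚ.< ¼ → Beyond d p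
Settled⇒Beyond up   {p} {q} q≥¾ near = near-≥¾ {p} {q} near q≥¾
Settled⇒Beyond down {p} {q} q≤¼ near = near-≤¼ {p} {q} near q≤¼

Beyond⇒Moves : ∀ d {p q} → Beyond d p → Beyond (opposite d) q → Moves (opposite d) p q
Beyond⇒Moves up   p q = ℚ.<-trans q p
Beyond⇒Moves down p q = ℚ.<-trans p q

-- Events of a computable approximation

module Levels (f : Str × Str → ℕ → ℚ) (f-computable : Computable f) where

  private
    numerator⁺ numerator⁻ denominator : PR 3
    numerator⁺  = proj₁ f-computable
    numerator⁻  = proj₁ (proj₂ f-computable)
    denominator = proj₁ (proj₂ (proj₂ f-computable))

    spec : ∀ x y s → let args = code x ∷ code y ∷ s ∷ [] in ∃[ α ] ∃[ β ] ∃[ γ ]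
      numerator⁺ ⟨ args ⟩⇓ α × numerator⁻ ⟨ args ⟩⇓ β × denominator ⟨ args ⟩⇓ γ ×
      f (x , y) s ≡ (α ⊖ β) / suc γ
    spec = proj₂ (proj₂ (proj₂ f-computable))

  value : ℕ → ℕ → ℕ → ℚ
  value x y s = f (decode x , decode y) s

  private
    α β γ : Vec ℕ 3 → ℕ
    α (x ∷ y ∷ s ∷ []) = proj₁ (spec (decode x) (decode y) s)
    β (x ∷ y ∷ s ∷ []) = proj₁ (proj₂ (spec (decode x) (decode y) s))
    γ (x ∷ y ∷ s ∷ []) = proj₁ (proj₂ (proj₂ (spec (decode x) (decode y) s)))

    α⇓ : ∀ xs → numerator⁺ ⟨ xs ⟩⇓ α xs
    α⇓ (x ∷ y ∷ s ∷ []) = subst₂ (λ x′ y′ → numerator⁺ ⟨ x′ ∷ y′ ∷ s ∷ [] ⟩⇓ α (x ∷ y ∷ s ∷ []))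
      (code-decode x) (code-decode y) (proj₁ (proj₂ (proj₂ (proj₂ (spec (decode x) (decode y) s)))))
    β⇓ : ∀ xs → numerator⁻ ⟨ xs ⟩⇓ β xs
    β⇓ (x ∷ y ∷ s ∷ []) = subst₂ (λ x′ y′ → numerator⁻ ⟨ x′ ∷ y′ ∷ s ∷ [] ⟩⇓ β (x ∷ y ∷ s ∷ []))
      (code-decode x) (code-decode y) (proj₁ (proj₂ (proj₂ (proj₂ (proj₂ (spec (decode x) (decode y) s))))))
    γ⇓ : ∀ xs → denominator ⟨ xs ⟩⇓ γ xs
    γ⇓ (x ∷ y ∷ s ∷ []) = subst₂ (λ x′ y′ → denominator ⟨ x′ ∷ y′ ∷ s ∷ [] ⟩⇓ γ (x ∷ y ∷ s ∷ []))
      (code-decode x) (code-decode y) (proj₁ (proj₂ (proj₂ (proj₂ (proj₂ (proj₂ (spec (decode x) (decode y) s)))))))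

    value≡ : ∀ x y s → let xs = x ∷ y ∷ s ∷ [] in value x y s ≡ (α xs ⊖ β xs) / suc (γ xs)
    value≡ x y s = proj₂ (proj₂ (proj₂ (proj₂ (proj₂ (proj₂ (spec (decode x) (decode y) s))))))

    αᵉ 2βᵉ+γᵉ : Exp 3
    αᵉ = lit 2 *ᵉ call numerator⁺ α α⇓ (var (# 0) ∷ var (# 1) ∷ var (# 2) ∷ [])
    2βᵉ+γᵉ = lit 2 *ᵉ call numerator⁻ β β⇓ (var (# 0) ∷ var (# 1) ∷ var (# 2) ∷ [])
      +ᵉ (lit 1 +ᵉ call denominator γ γ⇓ (var (# 0) ∷ var (# 1) ∷ var (# 2) ∷ []))

    beyondᵉ : Direction → Exp 3
    beyondᵉ up   = (lit 1 +ᵉ 2βᵉ+γᵉ) ∸ᵉ αᵉ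
    beyondᵉ down = (lit 1 +ᵉ αᵉ) ∸ᵉ 2βᵉ+γᵉ

    beyond-sound : ∀ d x y s → ⟦ beyondᵉ d ⟧ (x ∷ y ∷ s ∷ []) ≡ 0 → Beyond d (value x y s)
    beyond-sound up x y s holds = subst (½ ℚ.<_) (sym (value≡ x y s))
      (½<⊖/ {α xs} {β xs} {γ xs} (m∸n≡0⇒m≤n holds))
      where xs = x ∷ y ∷ s ∷ []
    beyond-sound down x y s holds = subst (ℚ._< ½) (sym (value≡ x y s))
      (⊖/<½ {α xs} {β xs} {γ xs} (m∸n≡0⇒m≤n holds))
      where xs = x ∷ y ∷ s ∷ []

    beyond-complete : ∀ d x y s → Beyond d (value x y s) → ⟦ beyondᵉ d ⟧ (x ∷ y ∷ s ∷ []) ≡ 0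
    beyond-complete up x y s beyond =
      m≤n⇒m∸n≡0 (½<⊖/⁻¹ {α xs} {β xs} {γ xs} (subst (½ ℚ.<_) (value≡ x y s) beyond))
      where xs = x ∷ y ∷ s ∷ []
    beyond-complete down x y s beyond =
      m≤n⇒m∸n≡0 (⊖/<½⁻¹ {α xs} {β xs} {γ xs} (subst (ℚ._< ½) (value≡ x y s) beyond))
      where xs = x ∷ y ∷ s ∷ []

  -- level j x y t is zero if before time t the approximation has gone through
  -- j events in the directions up, down, up, ….
  levelᵉ : ℕ → Exp 3
  levelᵉ zero    = lit 0
  levelᵉ (suc j) = ∏ᵉ (var (# 2)) (levelᵉ j [ var (# 1) ∷ var (# 2) ∷ var (# 0) ∷ [] ]ᵉ
                                   +ᵉ beyondᵉ (dir j) [ var (# 1) ∷ var (# 2) ∷ var (# 0) ∷ [] ]ᵉ)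

  level : ℕ → ℕ → ℕ → ℕ → ℕ
  level j x y t = ⟦ levelᵉ j ⟧ (x ∷ y ∷ t ∷ [])

  level-suc : ∀ j {x y s t} → s < t → level j x y s ≡ 0 → Beyond (dir j) (value x y s) →
              level (suc j) x y t ≡ 0
  level-suc j {x} {y} {s} {t} s<t reached beyond = ∃⇒∏≡0 t
    (λ s → level j x y s + ⟦ beyondᵉ (dir j) ⟧ (x ∷ y ∷ s ∷ [])) s<t
    (cong₂ _+_ reached (beyond-complete (dir j) x y s beyond))

  level-pred : ∀ j {x y t} → level (suc j) x y t ≡ 0 →
               ∃[ s ] s < t × level j x y s ≡ 0 × Beyond (dir j) (value x y s)
  level-pred j {x} {y} {t} reached
    with ∏≡0⇒∃ t (λ s → level j x y s + ⟦ beyondᵉ (dir j) ⟧ (x ∷ y ∷ s ∷ [])) reached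
  ... | s , s<t , eq = s , s<t , m+n≡0⇒m≡0 (level j x y s) eq ,
          beyond-sound (dir j) x y s (m+n≡0⇒n≡0 (level j x y s) eq)

  level-mono : ∀ j {x y s t} → s ≤ t → level j x y s ≡ 0 → level j x y t ≡ 0
  level-mono zero    _   _ = refl
  level-mono (suc j) s≤t reached with level-pred j {_} {_} {_} reached
  ... | r , r<s , reached′ , beyond = level-suc j (<-≤-trans r<s s≤t) reached′ beyond

  level-antitone : ∀ {i j x y t} → i ≤ j → level j x y t ≡ 0 → level i x y t ≡ 0
  level-antitone {i} {j} i≤j reached with m≤n⇒m<n∨m≡n i≤j
  ... | inj₂ refl = reached
  level-antitone {i} {suc j} _ reached | inj₁ i<1+j with level-pred j {_} {_} {_} reached
  ...   | s , s<t , reached′ , _ =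
          level-antitone (s≤s⁻¹ i<1+j) (level-mono j (<⇒≤ s<t) reached′)

  private
    -- Events are unwound from the last to the first, each putting one move in front of the zigzag
    -- built so far.
    Zigzag-extend : ∀ j {x y s k} → level j x y s ≡ 0 → Beyond (dir j) (value x y s) →
                    Zigzag (value x y) (opposite (dir j)) s k →
                    ∃[ d ] ∃[ s′ ] Zigzag (value x y) d s′ (j + k)
    Zigzag-extend zero    _       _      z = _ , _ , z
    Zigzag-extend (suc j) {x} {y} {k = k} reached beyond z with level-pred j {_} {_} {_} reached
    ... | s′ , s′<s , reached′ , beyond′
        with Zigzag-extend j {k = suc k} reached′ beyond′ (turn s′<s (Beyond⇒Moves (dir j) beyond′ beyond) z)
    ...   | d , r , z′ = d , r , subst (Zigzag _ d r) (+-suc j k) z′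

  -- Consecutive events lie strictly on opposite sides of ½, so 2 + j events give j + 1 alternating
  -- moves.
  level⇒Zigzag : ∀ j {x y t} → level (2 + j) x y t ≡ 0 → ∃[ d ] ∃[ s ] Zigzag (value x y) d s j
  level⇒Zigzag j {x} {y} {t} reached with level-pred (suc j) {x} {y} {t} reached
  ... | s , _ , reached′ , beyond with level-pred j {x} {y} {s} reached′
  ...   | s′ , s′<s , reached″ , beyond′
        with Zigzag-extend j {x} {y} {s′} reached″ beyond′ (move s′<s (Beyond⇒Moves (dir j) beyond′ beyond))
  ...     | d , r , z = d , r , subst (Zigzag _ d r) (+-identityʳ j) z

  -- The double subtraction turns every nonzero value into 1, so that sums count pairs.
  unreachedᵉ : ℕ → Exp 3
  unreachedᵉ j = lit 1 ∸ᵉ (lit 1 ∸ᵉ levelᵉ j)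

  unreached : ℕ → ℕ → ℕ → ℕ → ℕ
  unreached j x y t = ⟦ unreachedᵉ j ⟧ (x ∷ y ∷ t ∷ [])

  unreached≤1 : ∀ j x y t → unreached j x y t ≤ 1
  unreached≤1 j x y t = m∸n≤m 1 (1 ∸ level j x y t)

  unreached≡0⇒ : ∀ j x y t → unreached j x y t ≡ 0 → level j x y t ≡ 0
  unreached≡0⇒ j x y t eq with level j x y t
  ... | zero  = refl
  ... | suc l with () ← trans (sym eq) (cong (1 ∸_) (0∸n≡0 l))

  ⇒unreached≡0 : ∀ j x y t → level j x y t ≡ 0 → unreached j x y t ≡ 0
  ⇒unreached≡0 j x y t eq rewrite eq = refl

-- Blocks of height h consist of 2 ^ (C h * k) numbers, so the complexities at
-- consecutive heights differ by a factor 8, and the overhead 3k of a program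
-- is negligible already at height 0.
abstract
  C D : ℕ → ℕ
  C h = 16 * 8 ^ h
  D h = 7 * C h

  C-suc : ∀ h k → C (suc h) * k ≡ D h * k + C h * k
  C-suc h k = lemma (8 ^ h) k
    where
    lemma : ∀ e k → 16 * (8 * e) * k ≡ 7 * (16 * e) * k + 16 * e * k
    lemma = solve-∀

  C-suc-*8 : ∀ h k → C (suc h) * k ≡ 8 * (C h * k)
  C-suc-*8 h k = lemma (8 ^ h) k
    where
    lemma : ∀ e k → 16 * (8 * e) * k ≡ 8 * (16 * e * k)
    lemma = solve-∀

  13k≤Ck : ∀ h k → 13 * k ≤ C h * k
  13k≤Ck h k = *-monoˡ-≤ k (≤-trans (m≤m+n 13 3) (*-monoʳ-≤ 16 (m^n>0 8 h)))

k≤Ck : ∀ h k → k ≤ C h * k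
k≤Ck h k = ≤-trans (m≤m+n k (12 * k)) (13k≤Ck h k)

N-suc : ∀ h k → 2 ^ (C (suc h) * k) ≡ 2 ^ (D h * k) * 2 ^ (C h * k)
N-suc h k = trans (cong (2 ^_) (C-suc h k)) (^-distribˡ-+-* 2 (D h * k) (C h * k))

-- A conditional complexity of at least n - k against complexities of at most n + 3k gives a ratio
-- of at least ¾ when n ≥ 13k; hence the constant 13.
upper-margin : ∀ {n k} → 13 * k ≤ n → 3 * (n + 3 * k) ≤ 4 * (n ∸ k)
upper-margin {n} {k} 13k≤n =
  subst (λ n → 3 * (n + 3 * k) ≤ 4 * (n ∸ k)) (m+[n∸m]≡n 13k≤n) (margin (n ∸ 13 * k))
  where
  open ≤-Reasoning
  split : ∀ k e → 13 * k + e ≡ k + (12 * k + e)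
  split = solve-∀
  slack : ∀ k e → 3 * (13 * k + e + 3 * k) + e ≡ 4 * (12 * k + e)
  slack = solve-∀
  margin : ∀ e → 3 * (13 * k + e + 3 * k) ≤ 4 * (13 * k + e ∸ k)
  margin e = begin
    3 * (13 * k + e + 3 * k)     ≤⟨ m≤m+n _ e ⟩
    3 * (13 * k + e + 3 * k) + e ≡⟨ slack k e ⟩
    4 * (12 * k + e)             ≡⟨ cong (4 *_) (m+n∸m≡n k (12 * k + e)) ⟨
    4 * (k + (12 * k + e) ∸ k)   ≡⟨ cong (λ n → 4 * (n ∸ k)) (split k e) ⟨
    4 * (13 * k + e ∸ k)         ∎

-- Here x comes from a block with exponent 8n, while the conditional complexities are at most n +
-- 3k, so the ratio is at most ¼.
lower-margin : ∀ {n k} → 13 * k ≤ n → 4 * (n + 3 * k) ≤ 8 * n ∸ k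
lower-margin {n} {k} 13k≤n =
  subst (λ n → 4 * (n + 3 * k) ≤ 8 * n ∸ k) (m+[n∸m]≡n 13k≤n) (margin (n ∸ 13 * k))
  where
  open ≤-Reasoning
  split : ∀ k e → 8 * (13 * k + e) ≡ k + (103 * k + 8 * e)
  split = solve-∀
  slack : ∀ k e → 4 * (13 * k + e + 3 * k) + (39 * k + 4 * e) ≡ 103 * k + 8 * e
  slack = solve-∀
  margin : ∀ e → 4 * (13 * k + e + 3 * k) ≤ 8 * (13 * k + e) ∸ k
  margin e = begin
    4 * (13 * k + e + 3 * k)                    ≤⟨ m≤m+n _ (39 * k + 4 * e) ⟩
    4 * (13 * k + e + 3 * k) + (39 * k + 4 * e) ≡⟨ slack k e ⟩
    103 * k + 8 * e                             ≡⟨ m+n∸m≡n k (103 * k + 8 * e) ⟨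
    k + (103 * k + 8 * e) ∸ k                   ≡⟨ cong (_∸ k) (split k e) ⟨
    8 * (13 * k + e) ∸ k                        ∎

private
  exchange : ∀ a b c → a * (b * c) ≡ b * (a * c)
  exchange = solve-∀

∑∑-mono-+ : ∀ m n (f g h : ℕ → ℕ → ℕ) →
            (∀ i j → i < m → j < n → f i j ≤ g i j + h i j) →
            ∑ m (λ i → ∑ n (f i)) ≤ ∑ m (λ i → ∑ n (g i)) + ∑ m (λ i → ∑ n (h i))
∑∑-mono-+ m n f g h le = begin
  ∑ m (λ i → ∑ n (f i))                 ≤⟨ ∑-mono m (λ i i<m → ∑-mono n (λ j j<n → le i j i<m j<n)) ⟩
  ∑ m (λ i → ∑ n (λ j → g i j + h i j)) ≡⟨ ∑-cong m (λ i _ → ∑-+ n (g i) (h i)) ⟩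
  ∑ m (λ i → ∑ n (g i) + ∑ n (h i))     ≡⟨ ∑-+ m (λ i → ∑ n (g i)) (λ i → ∑ n (h i)) ⟩
  ∑ m (λ i → ∑ n (g i)) + ∑ m (λ i → ∑ n (h i)) ∎
  where open ≤-Reasoning

2^k*2^[n∸k] : ∀ {k n} → k ≤ n → 2 ^ k * 2 ^ (n ∸ k) ≡ 2 ^ n
2^k*2^[n∸k] {k} {n} k≤n = trans (sym (^-distribˡ-+-* 2 k (n ∸ k))) (cong (2 ^_) (m+[n∸m]≡n k≤n))

n<2^n : ∀ n → n < 2 ^ n
n<2^n zero    = s≤s z≤n
n<2^n (suc n) = begin-strict
  suc n         ≤⟨ n<2^n n ⟩
  2 ^ n         <⟨ m<m+n (2 ^ n) (m^n>0 2 n) ⟩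
  2 ^ n + 2 ^ n ≡⟨ cong (2 ^ n +_) (+-identityʳ (2 ^ n)) ⟨
  2 ^ suc n     ∎
  where open ≤-Reasoning

-- Alternation between squares of blocks and graphs of matched subblocks

module Pursuit (U : Machine) (prefixFree-U : PrefixFree U) (universal-U : Universal U)
               (K : Str → Str → ℕ) (K-complexity : IsComplexityOf U K)
               (f : Str × Str → ℕ → ℚ) (f-approximates : IsApproximation f (NID K)) where

  open Complexity U prefixFree-U universal-U K K-complexity
  open Levels f (proj₁ f-approximates)

  distance : ℕ → ℕ → ℚ
  distance x y = NID K (decode x , decode y)

  private
    settling : ∀ x y → ∃[ τ ] (∀ s → τ ≤ s → ℚ.∣ value x y s ℚ.- distance x y ∣ ℚ.< ¼)
    settling x y = proj₂ f-approximates (decode x , decode y) ¼ 0<¼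

  settling-time : ℕ → ℕ → ℕ
  settling-time x y = proj₁ (settling x y)

  -- A pair without the next event either lacked an earlier one at time t or has c < L, with c a
  -- complexity. The time is `suc s` because `level` counts events strictly before its time.
  advance : ∀ j {x y t s L c} → t ≤ s → settling-time x y ≤ s →
            (L ≤ c → Settled (dir j) (distance x y)) →
            unreached (suc j) x y (suc s) ≤ unreached j x y t + below L c
  advance j {x} {y} {t} {s} {L} {c} t≤s τ≤s settled with unreached j x y t in eq | L ≤? c
  ... | suc _ | _ = ≤-trans (unreached≤1 (suc j) x y (suc s)) (s≤s z≤n)
  ... | zero | no L≰c = ≤-trans (unreached≤1 (suc j) x y (suc s)) (≤-reflexive (sym (below≡1 (≰⇒> L≰c))))
  ... | zero | yes L≤c = ≤-trans (≤-reflexive (⇒unreached≡0 (suc j) x y (suc s)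
          (level-suc j {x} {y} {s} {suc s} (n<1+n s)
            (level-mono j {x} {y} {t} {s} t≤s (unreached≡0⇒ j x y t eq))
            (Settled⇒Beyond (dir j) (settled L≤c) (proj₂ (settling x y) s τ≤s))))) z≤n

  settled-up : ∀ {h k x y} → κ x 0 ≤ C h * k + 3 * k → κ y 0 ≤ C h * k + 3 * k →
               C h * k ∸ k ≤ κ x y → Settled up (distance x y)
  settled-up {h} {k} {x} {y} κx κy κxy = ¾≤ratio K (≤-trans (κ₀-positive x) (m≤m⊔n _ _)) (begin
    3 * (κ x 0 ⊔ κ y 0)   ≤⟨ *-monoʳ-≤ 3 (⊔-lub κx κy) ⟩
    3 * (C h * k + 3 * k) ≤⟨ upper-margin {C h * k} {k} (13k≤Ck h k) ⟩
    4 * (C h * k ∸ k)     ≤⟨ *-monoʳ-≤ 4 (≤-trans κxy (m≤m⊔n _ _)) ⟩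
    4 * (κ x y ⊔ κ y x)   ∎)
    where open ≤-Reasoning

  settled-down : ∀ {h k x y} → κ x y ≤ C h * k + 3 * k → κ y x ≤ C h * k + 3 * k →
                 C (suc h) * k ∸ k ≤ κ x 0 → Settled down (distance x y)
  settled-down {h} {k} {x} {y} κxy κyx κx = ratio≤¼ K (≤-trans (κ₀-positive x) (m≤m⊔n _ _)) (begin
    4 * (κ x y ⊔ κ y x)   ≤⟨ *-monoʳ-≤ 4 (⊔-lub κxy κyx) ⟩
    4 * (C h * k + 3 * k) ≤⟨ lower-margin {C h * k} {k} (13k≤Ck h k) ⟩
    8 * (C h * k) ∸ k     ≡⟨ cong (_∸ k) (C-suc-*8 h k) ⟨
    C (suc h) * k ∸ k     ≤⟨ κx ⟩
    κ x 0                 ≤⟨ m≤m⊔n _ _ ⟩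
    κ x 0 ⊔ κ y 0         ∎)
    where open ≤-Reasoning

  -- The number of pairs from blocks u and v of length N that have not gone through j events before
  -- t.
  square : ℕ → ℕ → ℕ → ℕ → ℕ → ℕ
  square j N u v t = ∑ N λ r → ∑ N λ s → unreached j (u * N + r) (v * N + s) t

  -- The same count over matched pairs only: u and v, of length R * N, are cut into R subblocks
  -- each, and w selects the matching.
  graph : ℕ → ℕ → ℕ → ℕ → ℕ → ℕ → ℕ → ℕ
  graph j R N u v w t = ∑ R λ a → square j N (u * R + a) (v * R + mate R w a) t

  squareᵉ : ∀ {n} → ℕ → (N u v t : Exp n) → Exp n
  squareᵉ j N u v t = body [ N ∷ u ∷ v ∷ t ∷ [] ]ᵉ
    where
    body : Exp 4
    -- Inside both sums the variables are s ∷ r ∷ N ∷ u ∷ v ∷ t.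
    body = ∑ᵉ (var (# 0)) (∑ᵉ (var (# 1)) (unreachedᵉ j
      [ var (# 3) *ᵉ var (# 2) +ᵉ var (# 1) ∷ var (# 4) *ᵉ var (# 2) +ᵉ var (# 0) ∷ var (# 5) ∷ [] ]ᵉ))

  mateᵉ : ∀ {n} → (R w a : Exp n) → Exp n
  mateᵉ R w a = (w ∸ᵉ a) +ᵉ (lit 1 ∸ᵉ (lit 1 ∸ᵉ (a ∸ᵉ w))) *ᵉ ((w +ᵉ R) ∸ᵉ a)

  -- The blocks are computed from k alone, so they add nothing to descriptions that already carry k.
  -- At most a fraction j / 2^k of the pairs is lost; the time t merely exists.
  SquareStage : ℕ → ℕ → Set
  SquareStage h j = ∃[ û ] ∃[ v̂ ] ∃[ k₀ ] (∀ k → k₀ ≤ k → let N = 2 ^ (C h * k) in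
    ∃[ u ] ∃[ v ] ∃[ t ] û ⟨ k ∷ [] ⟩⇓ u × v̂ ⟨ k ∷ [] ⟩⇓ v ×
    2 ^ k * square j N u v t ≤ j * (N * N))

  GraphStage : ℕ → ℕ → Set
  GraphStage h j = ∃[ û ] ∃[ v̂ ] ∃[ ŵ ] ∃[ k₀ ] (∀ k → k₀ ≤ k →
    let N = 2 ^ (C h * k); R = 2 ^ (D h * k) in
    ∃[ u ] ∃[ v ] ∃[ w ] ∃[ t ] û ⟨ k ∷ [] ⟩⇓ u × v̂ ⟨ k ∷ [] ⟩⇓ v × ŵ ⟨ k ∷ [] ⟩⇓ w ×
    2 ^ k * graph j R N u v w t ≤ j * (R * (N * N)))

  -- Only the offset r is given as data; u is recomputed from k.
  block-complexity : ∀ h (û : PR 1) → ∃[ k₀ ] (∀ {k u r} → k₀ ≤ k → û ⟨ k ∷ [] ⟩⇓ u →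
    r < 2 ^ (C h * k) → κ (u * 2 ^ (C h * k) + r) 0 ≤ C h * k + 3 * k)
  block-complexity h û = proj₁ described , λ {k} {u} {r} k₀≤k u⇓ r< →
    proj₂ described {k} {r} {0} k₀≤k r<
      (comp⇓ (comp⇓ (proj⇓ ∷ []) u⇓ ∷ proj⇓ ∷ proj⇓ ∷ []) (compile⇓ element (u ∷ k ∷ r ∷ [])))
    where
    element : Exp 3
    element = var (# 0) *ᵉ (2^ᵉ (lit (C h) *ᵉ var (# 1))) +ᵉ var (# 2)

    described = describe (C h) (comp (compile element)
      (comp û (proj (# 0) ∷ []) ∷ proj (# 0) ∷ proj (# 1) ∷ []))

  -- From the condition the machine recovers the subblock number a by division and computes its
  -- mate. Only the offset r inside the subblock remains to be given.
  mate-complexity : ∀ h (û v̂ ŵ : PR 1) → ∃[ k₀ ] (∀ {k u v w} → k₀ ≤ k →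
    û ⟨ k ∷ [] ⟩⇓ u → v̂ ⟨ k ∷ [] ⟩⇓ v → ŵ ⟨ k ∷ [] ⟩⇓ w →
    let N = 2 ^ (C h * k); R = 2 ^ (D h * k) in ∀ {a r s} → r < N → s < N →
    κ ((u * R + mate R w a) * N + r) ((v * R + a) * N + s) ≤ C h * k + 3 * k)
  mate-complexity h û v̂ ŵ = proj₁ described , bound
    where
    Nᵉ Rᵉ : ∀ {n} → Exp n → Exp n
    Nᵉ k = 2^ᵉ (lit (C h) *ᵉ k)
    Rᵉ k = 2^ᵉ (lit (D h) *ᵉ k)

    -- The variables are s ∷ c ∷ y ∷ v ∷ k, without s in width.
    width : Exp 4
    width = Nᵉ (var (# 3))
    locates : Exp 5
    locates = var (# 2) ≐ᵉ (var (# 3) *ᵉ Rᵉ (var (# 4)) +ᵉ var (# 1)) *ᵉ Nᵉ (var (# 4)) +ᵉ var (# 0)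

    open PairSearch width locates

    -- The variables are u ∷ w ∷ c ∷ k ∷ r.
    element : Exp 5
    element = (var (# 0) *ᵉ Rᵉ (var (# 3)) +ᵉ mateᵉ (Rᵉ (var (# 3))) (var (# 1)) (var (# 2)))
              *ᵉ Nᵉ (var (# 3)) +ᵉ var (# 4)

    at-k : PR 1 → PR 3
    at-k f = comp f (proj (# 0) ∷ [])

    described = describe (C h) (comp (compile element)
      (at-k û ∷ at-k ŵ ∷ comp outer (proj (# 2) ∷ at-k v̂ ∷ proj (# 0) ∷ []) ∷ proj (# 0) ∷ proj (# 1) ∷ []))

    bound : ∀ {k u v w} → proj₁ described ≤ k →
      û ⟨ k ∷ [] ⟩⇓ u → v̂ ⟨ k ∷ [] ⟩⇓ v → ŵ ⟨ k ∷ [] ⟩⇓ w →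
      let N = 2 ^ (C h * k); R = 2 ^ (D h * k) in ∀ {a r s} → r < N → s < N →
      κ ((u * R + mate R w a) * N + r) ((v * R + a) * N + s) ≤ C h * k + 3 * k
    bound {k} {u} {v} {w} k₀≤k u⇓ v⇓ w⇓ {a} {r} {s} r<N s<N
      with pair-search {y ∷ v ∷ k ∷ []} a s s<N (≡⇒dist≡0 {y} refl)
      where
      y = (v * 2 ^ (D h * k) + a) * 2 ^ (C h * k) + s
    ... | c , s′ , c⇓ , _ , s′<N , located
      with refl ← +-cancelˡ-≡ (v * 2 ^ (D h * k)) a c (block-unique s<N s′<N (dist≡0⇒≡ _ _ located)) =
      proj₂ described k₀≤k r<N
        (comp⇓ (comp⇓ (proj⇓ ∷ []) u⇓ ∷ comp⇓ (proj⇓ ∷ []) w⇓ ∷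
                comp⇓ (proj⇓ ∷ comp⇓ (proj⇓ ∷ []) v⇓ ∷ proj⇓ ∷ []) c⇓ ∷ proj⇓ ∷ proj⇓ ∷ [])
               (compile⇓ element (u ∷ w ∷ c ∷ k ∷ r ∷ [])))

  -- This time serves only to prove that the searches succeed; no program computes it.
  square-settling : ℕ → ℕ → ℕ → ℕ
  square-settling N u v = ⨆ N λ r → ⨆ N λ s → settling-time (u * N + r) (v * N + s)

  square-settled : ∀ {N r s} u v → r < N → s < N →
                   settling-time (u * N + r) (v * N + s) ≤ square-settling N u v
  square-settled {N} {r} {s} u v r<N s<N = ≤-trans
    (term≤⨆ (λ s → settling-time (u * N + r) (v * N + s)) s<N)
    (term≤⨆ (λ r → ⨆ N λ s → settling-time (u * N + r) (v * N + s)) r<N)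

  -- The new losses are pairs with K(x|y) < n - k, where N = 2ⁿ. Each y has at most 2^(n-k) such x,
  -- which is a fraction 2⁻ᵏ of the square.
  square-advance : ∀ {h j k u v t} → dir j ≡ up → let N = 2 ^ (C h * k) in
    (∀ {r} → r < N → κ (u * N + r) 0 ≤ C h * k + 3 * k) →
    (∀ {s} → s < N → κ (v * N + s) 0 ≤ C h * k + 3 * k) →
    2 ^ k * square j N u v t ≤ j * (N * N) →
    ∃[ t′ ] 2 ^ k * square (suc j) N u v t′ ≤ suc j * (N * N)
  square-advance {h} {j} {k} {u} {v} {t} j-up κu κv few = suc T , (begin
    2 ^ k * square (suc j) N u v (suc T)
      ≤⟨ *-monoʳ-≤ (2 ^ k) (∑∑-mono-+ N N _ (λ r s → unreached j (x r) (y s) t) compressible pointwise) ⟩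
    2 ^ k * (square j N u v t + ∑ N (λ r → ∑ N (compressible r)))
      ≤⟨ *-monoʳ-≤ (2 ^ k) (+-monoʳ-≤ (square j N u v t) few-compressible) ⟩
    2 ^ k * (square j N u v t + N * 2 ^ L)
      ≡⟨ *-distribˡ-+ (2 ^ k) (square j N u v t) (N * 2 ^ L) ⟩
    2 ^ k * square j N u v t + 2 ^ k * (N * 2 ^ L)
      ≤⟨ +-mono-≤ few (≤-reflexive (trans (exchange (2 ^ k) N (2 ^ L)) (cong (N *_) (2^k*2^[n∸k] (k≤Ck h k))))) ⟩
    j * (N * N) + N * N
      ≡⟨ +-comm (j * (N * N)) (N * N) ⟩
    suc j * (N * N) ∎)
    where
    open ≤-Reasoning
    N = 2 ^ (C h * k)
    L = C h * k ∸ k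
    T = t ⊔ square-settling N u v
    x y : ℕ → ℕ
    x r = u * N + r
    y s = v * N + s
    compressible : ℕ → ℕ → ℕ
    compressible r s = below L (κ (x r) (y s))
    pointwise : ∀ r s → r < N → s < N →
      unreached (suc j) (x r) (y s) (suc T) ≤ unreached j (x r) (y s) t + compressible r s
    pointwise r s r<N s<N = advance j {x r} {y s} {t} {T} {L} (m≤m⊔n t _)
      (≤-trans (square-settled u v r<N s<N) (m≤n⊔m t _))
      (λ high → subst (λ d → Settled d (distance (x r) (y s))) (sym j-up)
        (settled-up {h} {k} {x r} {y s} (κu r<N) (κv s<N) high))
    few-compressible : ∑ N (λ r → ∑ N (compressible r)) ≤ N * 2 ^ L
    few-compressible = begin
      ∑ N (λ r → ∑ N (compressible r))         ≡⟨ ∑-swap N N compressible ⟩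
      ∑ N (λ s → ∑ N (λ r → compressible r s)) ≤⟨ ∑-mono N (λ s _ → incompressible N (u * N) (y s) L) ⟩
      ∑ N (λ _ → 2 ^ L)                        ≡⟨ ∑-const N (2 ^ L) ⟩
      N * 2 ^ L                                ∎

  block-index : ∀ u R a N r → (u * R + a) * N + r ≡ u * (R * N) + (a * N + r)
  block-index = solve-∀

  -- The new losses are pairs whose x has K(x) < 8n - k, where N = 2ⁿ. There are at most 2^(8n-k)
  -- such x among the R * N elements of u, and each has N partners.
  graph-advance : ∀ {h j k u v w t} → dir j ≡ down →
    let N = 2 ^ (C h * k); R = 2 ^ (D h * k) in
    (∀ {a r s} → a < R → r < N → s < N →
      κ ((u * R + a) * N + r) ((v * R + mate R w a) * N + s) ≤ C h * k + 3 * k) →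
    (∀ {a r s} → a < R → r < N → s < N →
      κ ((v * R + mate R w a) * N + s) ((u * R + a) * N + r) ≤ C h * k + 3 * k) →
    2 ^ k * graph j R N u v w t ≤ j * (R * (N * N)) →
    ∃[ t′ ] 2 ^ k * graph (suc j) R N u v w t′ ≤ suc j * (R * (N * N))
  graph-advance {h} {j} {k} {u} {v} {w} {t} j-down κxy κyx few = suc T , (begin
    2 ^ k * graph (suc j) R N u v w (suc T)
      ≤⟨ *-monoʳ-≤ (2 ^ k) (∑-mono R λ a a<R →
           ∑∑-mono-+ N N _ (λ r s → unreached j (x a r) (y a s) t) (λ r _ → compressible a r) (pointwise a a<R)) ⟩
    2 ^ k * ∑ R (λ a → square j N (u * R + a) (v * R + mate R w a) t + ∑ N (λ r → ∑ N (λ _ → compressible a r)))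
      ≡⟨ cong (2 ^ k *_) (∑-+ R _ _) ⟩
    2 ^ k * (graph j R N u v w t + ∑ R (λ a → ∑ N (λ r → ∑ N (λ _ → compressible a r))))
      ≤⟨ *-monoʳ-≤ (2 ^ k) (+-monoʳ-≤ (graph j R N u v w t) few-compressible) ⟩
    2 ^ k * (graph j R N u v w t + N * 2 ^ L)
      ≡⟨ *-distribˡ-+ (2 ^ k) (graph j R N u v w t) (N * 2 ^ L) ⟩
    2 ^ k * graph j R N u v w t + 2 ^ k * (N * 2 ^ L)
      ≤⟨ +-mono-≤ few (≤-reflexive (trans (exchange (2 ^ k) N (2 ^ L))
           (trans (cong (N *_) (trans (2^k*2^[n∸k] (k≤Ck (suc h) k)) (N-suc h k))) (exchange N R N)))) ⟩
    j * (R * (N * N)) + R * (N * N)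
      ≡⟨ +-comm (j * (R * (N * N))) (R * (N * N)) ⟩
    suc j * (R * (N * N)) ∎)
    where
    open ≤-Reasoning
    N = 2 ^ (C h * k)
    R = 2 ^ (D h * k)
    L = C (suc h) * k ∸ k
    T = t ⊔ ⨆ R (λ a → square-settling N (u * R + a) (v * R + mate R w a))
    x y : ℕ → ℕ → ℕ
    x a r = (u * R + a) * N + r
    y a s = (v * R + mate R w a) * N + s
    compressible : ℕ → ℕ → ℕ
    compressible a r = below L (κ (x a r) 0)
    pointwise : ∀ a → a < R → ∀ r s → r < N → s < N →
      unreached (suc j) (x a r) (y a s) (suc T) ≤ unreached j (x a r) (y a s) t + compressible a r
    pointwise a a<R r s r<N s<N = advance j {x a r} {y a s} {t} {T} {L} (m≤m⊔n t _)
      (≤-trans (square-settled (u * R + a) (v * R + mate R w a) r<N s<N)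
        (≤-trans (term≤⨆ (λ a → square-settling N (u * R + a) (v * R + mate R w a)) a<R) (m≤n⊔m t _)))
      (λ high → subst (λ d → Settled d (distance (x a r) (y a s))) (sym j-down)
        (settled-down {h} {k} {x a r} {y a s} (κxy a<R r<N s<N) (κyx a<R r<N s<N) high))
    few-compressible : ∑ R (λ a → ∑ N (λ r → ∑ N (λ _ → compressible a r))) ≤ N * 2 ^ L
    few-compressible = begin
      ∑ R (λ a → ∑ N (λ r → ∑ N (λ _ → compressible a r)))
        ≡⟨ ∑-cong R (λ a _ → trans (∑-cong N (λ r _ → ∑-const N (compressible a r)))
             (sym (*-∑ N N (compressible a)))) ⟩
      ∑ R (λ a → N * ∑ N (compressible a))
        ≡⟨ *-∑ N R (λ a → ∑ N (compressible a)) ⟨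
      N * ∑ R (λ a → ∑ N (compressible a))
        ≡⟨ cong (N *_) (∑-cong R (λ a _ → ∑-cong N (λ r _ →
             cong (λ z → below L (κ z 0)) (block-index u R a N r)))) ⟩
      N * ∑ R (λ a → ∑ N (λ r → below L (κ (u * (R * N) + (a * N + r)) 0)))
        -- The subblocks are reassembled into u, so that compressible elements are counted once for
        -- the whole block.
        ≡⟨ cong (N *_) (∑-blocks R N (λ i → below L (κ (u * (R * N) + i) 0))) ⟨
      N * ∑ (R * N) (λ i → below L (κ (u * (R * N) + i) 0))
        ≤⟨ *-monoʳ-≤ N (incompressible (R * N) (u * (R * N)) 0 L) ⟩
      N * 2 ^ L ∎

  square-blocks : ∀ j R N u v t →
    square j (R * N) u v t ≡ ∑ R λ a → ∑ R λ c → square j N (u * R + a) (v * R + c) t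
  square-blocks j R N u v t = begin
    ∑ (R * N) (λ i → ∑ (R * N) (G i))
      ≡⟨ ∑-blocks R N _ ⟩
    ∑ R (λ a → ∑ N (λ r → ∑ (R * N) (G (a * N + r))))
      ≡⟨ ∑-cong R (λ a _ → ∑-cong N (λ r _ → ∑-blocks R N (G (a * N + r)))) ⟩
    ∑ R (λ a → ∑ N (λ r → ∑ R (λ c → ∑ N (λ s → G (a * N + r) (c * N + s)))))
      ≡⟨ ∑-cong R (λ a _ → ∑-swap N R (λ r c → ∑ N (λ s → G (a * N + r) (c * N + s)))) ⟩
    ∑ R (λ a → ∑ R (λ c → ∑ N (λ r → ∑ N (λ s → G (a * N + r) (c * N + s)))))
      ≡⟨ ∑-cong R (λ a _ → ∑-cong R (λ c _ → ∑-cong N (λ r _ → ∑-cong N (λ s _ →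
           cong₂ (λ x y → unreached j x y t) (sym (block-index u R a N r)) (sym (block-index v R c N s)))))) ⟩
    ∑ R (λ a → ∑ R (λ c → square j N (u * R + a) (v * R + c) t)) ∎
    where
    open ≡-Reasoning
    G : ℕ → ℕ → ℕ
    G r s = unreached j (u * (R * N) + r) (v * (R * N) + s) t

  -- Each pair of subblocks is matched for exactly one w, so the R graphs partition the square and
  -- some w is no worse than average.
  ∑-graph : ∀ j R N u v t → ∑ R (λ w → graph j R N u v w t) ≡ square j (R * N) u v t
  ∑-graph j R N u v t = begin
    ∑ R (λ w → ∑ R (λ a → square j N (u * R + a) (v * R + mate R w a) t))
      ≡⟨ ∑-swap R R _ ⟩
    ∑ R (λ a → ∑ R (λ w → square j N (u * R + a) (v * R + mate R w a) t))
      ≡⟨ ∑-cong R (λ a a<R → ∑-mate (λ c → square j N (u * R + a) (v * R + c) t) a<R) ⟩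
    ∑ R (λ a → ∑ R (λ c → square j N (u * R + a) (v * R + c) t))
      ≡⟨ square-blocks j R N u v t ⟨
    square j (R * N) u v t ∎
    where open ≡-Reasoning

  choose-graph : ∀ {j k R N u v t} → 0 < R → 2 ^ k * square j (R * N) u v t ≤ j * ((R * N) * (R * N)) →
                 ∃[ w ] w < R × 2 ^ k * graph j R N u v w t ≤ j * (R * (N * N))
  choose-graph {j} {k} {R} {N} {u} {v} {t} 0<R few = average R _ 0<R (begin
    ∑ R (λ w → 2 ^ k * graph j R N u v w t) ≡⟨ *-∑ (2 ^ k) R _ ⟨
    2 ^ k * ∑ R (λ w → graph j R N u v w t) ≡⟨ cong (2 ^ k *_) (∑-graph j R N u v t) ⟩
    2 ^ k * square j (R * N) u v t          ≤⟨ few ⟩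
    j * ((R * N) * (R * N))                 ≡⟨ rearrange j R N ⟩
    R * (j * (R * (N * N)))                 ∎)
    where
    open ≤-Reasoning
    rearrange : ∀ j R N → j * ((R * N) * (R * N)) ≡ R * (j * (R * (N * N)))
    rearrange = solve-∀

  choose-square : ∀ {j k R N u v w t} → 0 < R → 2 ^ k * graph j R N u v w t ≤ j * (R * (N * N)) →
                  ∃[ a ] a < R × 2 ^ k * square j N (u * R + a) (v * R + mate R w a) t ≤ j * (N * N)
  choose-square {j} {k} {R} {N} {u} {v} {w} {t} 0<R few = average R _ 0<R (begin
    ∑ R (λ a → 2 ^ k * square j N (u * R + a) (v * R + mate R w a) t) ≡⟨ *-∑ (2 ^ k) R _ ⟨
    2 ^ k * graph j R N u v w t                                       ≤⟨ few ⟩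
    j * (R * (N * N))                                                 ≡⟨ exchange j R (N * N) ⟩
    R * (j * (N * N))                                                 ∎)
    where
    open ≤-Reasoning

  abstract
    -- The given t and w only guarantee success; the search may find others. Its test `good` is the
    -- truncated difference of the two sides, zero exactly when the inequality holds.
    graph-search : ∀ h j → ∃[ ŵ ] (∀ {u v k} t w → let N = 2 ^ (C h * k); R = 2 ^ (D h * k) in
      w < R → 2 ^ k * graph j R N u v w t ≤ j * (R * (N * N)) →
      ∃[ w′ ] ∃[ t′ ] ŵ ⟨ u ∷ v ∷ k ∷ [] ⟩⇓ w′ × 2 ^ k * graph j R N u v w′ t′ ≤ j * (R * (N * N)))
    graph-search h j = inner , λ {u} {v} {k} t w w<R few →
      let N = 2 ^ (C h * k); R = 2 ^ (D h * k)
          (t′ , w′ , _ , w⇓ , _ , found) = pair-search {u ∷ v ∷ k ∷ []} t w w<R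
            (m≤n⇒m∸n≡0 {2 ^ k * graph j R N u v w t} {j * (R * (N * N))} few)
      in w′ , t′ , w⇓ , m∸n≡0⇒m≤n {2 ^ k * graph j R N u v w′ t′} {j * (R * (N * N))} found
      where
      Nᵉ Rᵉ : ∀ {n} → Exp n → Exp n
      Nᵉ k = 2^ᵉ (lit (C h) *ᵉ k)
      Rᵉ k = 2^ᵉ (lit (D h) *ᵉ k)

      -- The variables are w ∷ t ∷ u ∷ v ∷ k.
      good : Exp 5
      good = (2^ᵉ var (# 4)) *ᵉ ∑ᵉ (Rᵉ (var (# 4))) (squareᵉ j (Nᵉ (var (# 5)))
               (var (# 3) *ᵉ Rᵉ (var (# 5)) +ᵉ var (# 0))
               (var (# 4) *ᵉ Rᵉ (var (# 5)) +ᵉ mateᵉ (Rᵉ (var (# 5))) (var (# 1)) (var (# 0)))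
               (var (# 2)))
             ∸ᵉ lit j *ᵉ (Rᵉ (var (# 4)) *ᵉ (Nᵉ (var (# 4)) *ᵉ Nᵉ (var (# 4))))

      open PairSearch (Rᵉ (var (# 3))) good

    square-search : ∀ h j → ∃[ â ] (∀ {u v w k} t a → let N = 2 ^ (C h * k); R = 2 ^ (D h * k) in
      a < R → 2 ^ k * square j N (u * R + a) (v * R + mate R w a) t ≤ j * (N * N) →
      ∃[ a′ ] ∃[ t′ ] â ⟨ u ∷ v ∷ w ∷ k ∷ [] ⟩⇓ a′ ×
      2 ^ k * square j N (u * R + a′) (v * R + mate R w a′) t′ ≤ j * (N * N))
    square-search h j = inner , λ {u} {v} {w} {k} t a a<R few →
      let N = 2 ^ (C h * k); R = 2 ^ (D h * k)
          (t′ , a′ , _ , a⇓ , _ , found) = pair-search {u ∷ v ∷ w ∷ k ∷ []} t a a<R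
            (m≤n⇒m∸n≡0 {2 ^ k * square j N (u * R + a) (v * R + mate R w a) t} {j * (N * N)} few)
      in a′ , t′ , a⇓ ,
         m∸n≡0⇒m≤n {2 ^ k * square j N (u * R + a′) (v * R + mate R w a′) t′} {j * (N * N)} found
      where
      Nᵉ Rᵉ : ∀ {n} → Exp n → Exp n
      Nᵉ k = 2^ᵉ (lit (C h) *ᵉ k)
      Rᵉ k = 2^ᵉ (lit (D h) *ᵉ k)

      -- The variables are a ∷ t ∷ u ∷ v ∷ w ∷ k.
      good : Exp 6
      good = (2^ᵉ var (# 5)) *ᵉ squareᵉ j (Nᵉ (var (# 5)))
               (var (# 2) *ᵉ Rᵉ (var (# 5)) +ᵉ var (# 0))
               (var (# 3) *ᵉ Rᵉ (var (# 5)) +ᵉ mateᵉ (Rᵉ (var (# 5))) (var (# 4)) (var (# 0)))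
               (var (# 1))
             ∸ᵉ lit j *ᵉ (Nᵉ (var (# 5)) *ᵉ Nᵉ (var (# 5)))

      open PairSearch (Rᵉ (var (# 4))) good

  -- The blocks stay the same. Incompressibility brings the next event, averaging yields a matching,
  -- and the search makes its index computable from k.
  square⇒graph : ∀ {h j} → dir j ≡ up → SquareStage (suc h) j → GraphStage h (suc j)
  square⇒graph {h} {j} j-up (û , v̂ , k₀ , stage) =
    û , v̂ , comp (proj₁ (graph-search h (suc j))) inputs , k₀ ⊔ (k₁ ⊔ k₂) , next
    where
    k₁ = proj₁ (block-complexity (suc h) û)
    k₂ = proj₁ (block-complexity (suc h) v̂)

    inputs : Vec (PR 1) 3
    inputs = û ∷ v̂ ∷ proj (# 0) ∷ []

    next : ∀ k → k₀ ⊔ (k₁ ⊔ k₂) ≤ k → let N = 2 ^ (C h * k); R = 2 ^ (D h * k) in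
      ∃[ u ] ∃[ v ] ∃[ w ] ∃[ t ] û ⟨ k ∷ [] ⟩⇓ u × v̂ ⟨ k ∷ [] ⟩⇓ v ×
      comp (proj₁ (graph-search h (suc j))) inputs ⟨ k ∷ [] ⟩⇓ w ×
      2 ^ k * graph (suc j) R N u v w t ≤ suc j * (R * (N * N))
    next k k≥ =
      let N = 2 ^ (C h * k); R = 2 ^ (D h * k)
          (u , v , t , u⇓ , v⇓ , few) = stage k (m⊔n≤o⇒m≤o k₀ _ k≥)
          (t₁ , few₁) = square-advance {suc h} {j} {k} {u} {v} {t} j-up
            (proj₂ (block-complexity (suc h) û) (m⊔n≤o⇒m≤o k₁ k₂ (m⊔n≤o⇒n≤o k₀ _ k≥)) u⇓)
            (proj₂ (block-complexity (suc h) v̂) (m⊔n≤o⇒n≤o k₁ k₂ (m⊔n≤o⇒n≤o k₀ _ k≥)) v⇓) few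
          (w , w<R , few₂) = choose-graph {suc j} {k} {R} {N} {u} {v} {t₁} (m^n>0 2 (D h * k))
            (subst (λ N → 2 ^ k * square (suc j) N u v t₁ ≤ suc j * (N * N)) (N-suc h k) few₁)
          (w′ , t′ , w⇓ , few′) = proj₂ (graph-search h (suc j)) {u} {v} {k} t₁ w w<R few₂
      in u , v , w′ , t′ , u⇓ , v⇓ , comp⇓ (u⇓ ∷ v⇓ ∷ proj⇓ ∷ []) w⇓ , few′

  -- Matching makes both conditional complexities small, which brings the next event. The new blocks
  -- are one matched pair of subblocks, again found by search.
  graph⇒square : ∀ {h j} → dir j ≡ down → GraphStage h j → SquareStage h (suc j)
  graph⇒square {h} {j} j-down (û , v̂ , ŵ , k₀ , stage) = û′ , v̂′ , k₀ ⊔ (k₁ ⊔ k₂) , next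
    where
    k₁ = proj₁ (mate-complexity h û v̂ ŵ)
    k₂ = proj₁ (mate-complexity h v̂ û ŵ)

    inputs : Vec (PR 1) 4
    inputs = û ∷ v̂ ∷ ŵ ∷ proj (# 0) ∷ []

    -- The variables are a ∷ u ∷ v ∷ w ∷ k.
    uᵉ vᵉ Rᵉ : Exp 5
    Rᵉ = 2^ᵉ (lit (D h) *ᵉ var (# 4))
    uᵉ = var (# 1) *ᵉ Rᵉ +ᵉ var (# 0)
    vᵉ = var (# 2) *ᵉ Rᵉ +ᵉ mateᵉ Rᵉ (var (# 3)) (var (# 0))

    û′ v̂′ : PR 1
    û′ = comp (compile uᵉ) (comp (proj₁ (square-search h (suc j))) inputs ∷ inputs)
    v̂′ = comp (compile vᵉ) (comp (proj₁ (square-search h (suc j))) inputs ∷ inputs)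

    next : ∀ k → k₀ ⊔ (k₁ ⊔ k₂) ≤ k → let N = 2 ^ (C h * k) in
      ∃[ u ] ∃[ v ] ∃[ t ] û′ ⟨ k ∷ [] ⟩⇓ u × v̂′ ⟨ k ∷ [] ⟩⇓ v ×
      2 ^ k * square (suc j) N u v t ≤ suc j * (N * N)
    next k k≥ =
      let N = 2 ^ (C h * k); R = 2 ^ (D h * k)
          (u , v , w , t , u⇓ , v⇓ , w⇓ , few) = stage k (m⊔n≤o⇒m≤o k₀ _ k≥)
          k₁≤k = m⊔n≤o⇒m≤o k₁ k₂ (m⊔n≤o⇒n≤o k₀ _ k≥)
          k₂≤k = m⊔n≤o⇒n≤o k₁ k₂ (m⊔n≤o⇒n≤o k₀ _ k≥)
          (t₁ , few₁) = graph-advance {h} {j} {k} {u} {v} {w} {t} j-down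
            (λ {a} {r} {s} a<R r<N s<N →
              -- The condition y lies in subblock `mate R w a` of v, whose own mate is a.
              subst (λ b → κ ((u * R + b) * N + r) ((v * R + mate R w a) * N + s) ≤ C h * k + 3 * k)
                (mate-involutive {R} {w} {a} a<R)
                (proj₂ (mate-complexity h û v̂ ŵ) k₁≤k u⇓ v⇓ w⇓ {mate R w a} {r} {s} r<N s<N))
            (λ {a} {r} {s} a<R r<N s<N →
              proj₂ (mate-complexity h v̂ û ŵ) k₂≤k v⇓ u⇓ w⇓ {a} {s} {r} s<N r<N)
            few
          (a , a<R , few₂) = choose-square {suc j} {k} {R} {N} {u} {v} {w} {t₁} (m^n>0 2 (D h * k)) few₁
          (a′ , t′ , a⇓ , few′) = proj₂ (square-search h (suc j)) {u} {v} {w} {k} t₁ a a<R few₂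
          inputs⇓ = u⇓ ∷ v⇓ ∷ w⇓ ∷ proj⇓ ∷ []
      in u * R + a′ , v * R + mate R w a′ , t′ ,
         comp⇓ (comp⇓ inputs⇓ a⇓ ∷ inputs⇓) (compile⇓ uᵉ (a′ ∷ u ∷ v ∷ w ∷ k ∷ [])) ,
         comp⇓ (comp⇓ inputs⇓ a⇓ ∷ inputs⇓) (compile⇓ vᵉ (a′ ∷ u ∷ v ∷ w ∷ k ∷ [])) ,
         few′

  initial-square : ∀ h → SquareStage h 0
  initial-square h = constant 0 , constant 0 , 0 , λ k _ → 0 , 0 , 0 , const⇓ 0 , const⇓ 0 ,
    ≤-reflexive (let N = 2 ^ (C h * k) in begin
      2 ^ k * square 0 N 0 0 0    ≡⟨ cong (2 ^ k *_) (∑-cong N (λ _ _ → trans (∑-const N 0) (*-zeroʳ N))) ⟩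
      2 ^ k * ∑ N (λ _ → 0)       ≡⟨ cong (2 ^ k *_) (trans (∑-const N 0) (*-zeroʳ N)) ⟩
      2 ^ k * 0                   ≡⟨ *-zeroʳ (2 ^ k) ⟩
      0                           ∎)
    where open ≡-Reasoning

  -- Each height contributes an event up and an event down, so the direction is `up` again at the
  -- next height.
  descend : ∀ h {j} → dir j ≡ up → SquareStage h j → ∃[ j′ ] h + j ≤ j′ × SquareStage 0 j′
  descend zero    {j} j-up stage = j , ≤-refl , stage
  descend (suc h) {j} j-up stage =
    let (j′ , le , stage′) = descend h {2 + j} (cong (opposite ∘ opposite) j-up)
          (graph⇒square {h} {suc j} (cong opposite j-up) (square⇒graph {h} {j} j-up stage))
    in j′ , ≤-trans (≤-trans (n≤1+n _) (≤-reflexive (rearrange h j))) le , stage′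
    where
    rearrange : ∀ h j → suc (suc h + j) ≡ h + (2 + j)
    rearrange = solve-∀

  square-reaches : ∀ {j N u v t} → square j N u v t < N * N → ∃[ x ] ∃[ y ] level j x y t ≡ 0
  square-reaches {j} {N} {u} {v} {t} few =
    let (r , _ , row<) = ∑<⇒∃< N (λ r → ∑ N λ s → unreached j (u * N + r) (v * N + s) t) {N} few
        (s , _ , z<1) = ∑<⇒∃< N (λ s → unreached j (u * N + r) (v * N + s) t) {1}
          (≤-trans row< (≤-reflexive (sym (*-identityʳ N))))
    in u * N + r , v * N + s , unreached≡0⇒ j (u * N + r) (v * N + s) t (n<1⇒n≡0 z<1)

  stage-reaches : ∀ {h j} → SquareStage h j → ∃[ x ] ∃[ y ] ∃[ t ] level j x y t ≡ 0
  stage-reaches {h} {j} (_ , _ , k₀ , stage) =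
    let (u , v , t , _ , _ , few) = stage k (m≤m⊔n k₀ j)
        (x , y , reached) = square-reaches {j} {N} {u} {v} {t} (*-cancelˡ-< (2 ^ k) _ _ (begin-strict
          2 ^ k * square j N u v t  ≤⟨ few ⟩
          j * (N * N)               <⟨ *-monoˡ-< (N * N) {{N²≢0}} j<2^k ⟩
          2 ^ k * (N * N)           ∎))
    in x , y , t , reached
    where
    open ≤-Reasoning
    -- Then j < 2^k, so the lost fraction j / 2^k is below 1 and some pair survives.
    k = k₀ ⊔ j
    N = 2 ^ (C h * k)
    N²≢0 : NonZero (N * N)
    N²≢0 = >-nonZero (*-mono-< (m^n>0 2 (C h * k)) (m^n>0 2 (C h * k)))
    j<2^k : j < 2 ^ k
    j<2^k = <-≤-trans (n<2^n j) (^-monoʳ-≤ 2 (m≤n⊔m k₀ j))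

  unbounded : ¬ (∃[ b ] (∀ z → OscillationsAtMost b (f z)))
  unbounded (b , bounded) =
    -- A zigzag with b + 1 turns contradicts the bound b, and `level⇒Zigzag` needs 3 + b events for
    -- it.
    let (j , le , stage) = descend (3 + b) {0} refl (initial-square (3 + b))
        (x , y , t , reached) = stage-reaches {0} {j} stage
        (d , s , zigzag) = level⇒Zigzag (suc b) {x} {y} {t}
          (level-antitone {3 + b} {j} {x} {y} {t} (≤-trans (m≤m+n (3 + b) 0) le) reached)
    in bounded (decode x , decode y) d s zigzag

mainTheorem13 : (U : Machine) → UniversalPrefixFree U →
    (K : Str → Str → ℕ) → IsComplexityOf U K →
    ((n : ℕ) .{{_ : NonZero n}} → ¬ (NID K ∈Σ[ n ]) × ¬ (NID K ∈Π[ n ]))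
    × ((f : Str × Str → ℕ → ℚ) → IsApproximation f (NID K) →
    ¬ (∃[ b ] (∀ z → OscillationsAtMost b (f z))))
mainTheorem13 U (prefixFree-U , universal-U) K K-complexity = hierarchy , unbounded
  where
  open Pursuit U prefixFree-U universal-U K K-complexity using (unbounded)

  hierarchy : (n : ℕ) .{{_ : NonZero n}} → ¬ (NID K ∈Σ[ n ]) × ¬ (NID K ∈Π[ n ])
  hierarchy (suc n) =
    (λ (f , approximates , sequences) → unbounded f approximates
      (oscillations n , λ z → ΣSequence⇒oscillations n (sequences z))) ,
    (λ (f , approximates , sequences) → unbounded f approximates
      (oscillations n , λ z → ΠSequence⇒oscillations n (sequences z)))
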